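{- Let $\mathbf s$ be a recurrent balanced infinite word with alphabet $\mathcal A$, $|\mathcal A|>2$, having fewer than $|\mathcal A|$ oddities. Then either $\mathbf s$ is episturmian or two distinct letters of $\mathbf s$ have the same frequency.
   Context: Recurrent: every factor occurs infinitely often. Balanced: for any two factors $u,v$ of equal length and any letter $x$, the numbers of occurrences of $x$ in $u$ and $v$ differ by at most 1. A complete return to a factor $u$ is a factor containing exactly two occurrences of $u$, one as prefix and one as suffix. An oddity of a word $\mathbf t$ is an unordered pair $\{w,\tilde w\}$ ($\tilde w$ the reversal of $w$) such that $w$ or $\tilde w$ is a non-palindromic complete return in $\mathbf t$ to some non-empty palindromic factor of $\mathbf t$. An infinite word is episturmian if its set of factors is closed under reversal and for each $n$ it has at most one factor $u$ of length $n$ such that $ux,uy$ are factors for two distinct letters $x,y$. The frequency of a letter $a$ is $\lim_n |\mathbf s_n|_a/n$, $\mathbf s_n$ the length-$n$ prefix. -}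

module Defs where

open import Data.Nat using (ℕ; zero; suc; _+_; _*_; _∸_; _≤_; _<_; ∣_-_∣)
open import Data.Fin using (Fin)
open import Data.Fin.Properties using (_≟_)
open import Data.List using (List; []; _∷_; _++_; [_]; length; reverse; take; drop)
open import Data.List.Membership.Propositional using (_∈_)
open import Data.Product using (Σ; ∃; ∃-syntax; _×_; _,_)
open import Data.Sum using (_⊎_)
open import Relation.Nullary using (¬_; yes; no)
open import Relation.Binary.PropositionalEquality using (_≡_; _≢_)

Word : ℕ → Set
Word k = ℕ → Fin k

sub : ∀ {k} → Word k → ℕ → ℕ → List (Fin k)
sub s i zero    = []
sub s i (suc n) = s i ∷ sub s (suc i) n

occ : ∀ {k} → Fin k → List (Fin k) → ℕ
occ x [] = 0
occ x (y ∷ w) with y ≟ x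
... | yes _ = suc (occ x w)
... | no  _ = occ x w

Factor : ∀ {k} → Word k → List (Fin k) → Set
Factor s u = ∃[ i ] sub s i (length u) ≡ u

Recurrent : ∀ {k} → Word k → Set
Recurrent s = ∀ u → Factor s u → ∀ m → ∃[ i ] (m ≤ i × sub s i (length u) ≡ u)

Balanced : ∀ {k} → Word k → Set
Balanced {k} s = ∀ (i j n : ℕ) (x : Fin k) → occ x (sub s i n) ≤ occ x (sub s j n) + 1

Palindrome : ∀ {k} → List (Fin k) → Set
Palindrome w = reverse w ≡ w

OccAt : ∀ {k} → List (Fin k) → List (Fin k) → ℕ → Set
OccAt u w p = (p + length u ≤ length w) × (take (length u) (drop p w) ≡ u)

CompleteReturn : ∀ {k} → List (Fin k) → List (Fin k) → Set
CompleteReturn u w =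
  (length u < length w) × OccAt u w 0 × OccAt u w (length w ∸ length u)
  × (∀ p → OccAt u w p → (p ≡ 0) ⊎ (p ≡ length w ∸ length u))

OddityRep : ∀ {k} → Word k → List (Fin k) → Set
OddityRep s w =
  Factor s w × ¬ Palindrome w ×
  ∃[ u ] (u ≢ [] × Factor s u × Palindrome u × CompleteReturn u w)

-- {w, reverse w} is an oddity of s
Oddity : ∀ {k} → Word k → List (Fin k) → Set
Oddity s w = OddityRep s w ⊎ OddityRep s (reverse w)

-- s has fewer than m oddities: some list of fewer than m words contains
-- a representative (w or its reversal) of every oddity {w, reverse w}
FewerOdditiesThan : ∀ {k} → Word k → ℕ → Set
FewerOdditiesThan {k} s m =
  ∃[ L ] (length L < m × (∀ (w : List (Fin k)) → Oddity s w → (w ∈ L) ⊎ (reverse w ∈ L)))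

RightSpecial : ∀ {k} → Word k → List (Fin k) → Set
RightSpecial s u = ∃[ x ] ∃[ y ] (x ≢ y × Factor s (u ++ [ x ]) × Factor s (u ++ [ y ]))

Episturmian : ∀ {k} → Word k → Set
Episturmian {k} s =
  (∀ u → Factor s u → Factor s (reverse u)) ×
  (∀ (u v : List (Fin k)) → length u ≡ length v → RightSpecial s u → RightSpecial s v → u ≡ v)

pref : ∀ {k} → Word k → Fin k → ℕ → ℕ
pref s a n = occ a (sub s 0 n)

-- the frequency of a exists: (pref s a n / n) is Cauchy, i.e.
-- ∀ k ∃ N ∀ m n ≥ N, |pref m / m - pref n / n| ≤ 1/(k+1)   (cross-multiplied)
FrequencyExists : ∀ {k} → Word k → Fin k → Set
FrequencyExists s a =
  ∀ e → ∃[ N ] ∀ m n → suc N ≤ m → suc N ≤ n →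
    suc e * ∣ pref s a m * n - pref s a n * m ∣ ≤ m * n

-- frequencies of a and b both exist and are equal:
-- (pref a n - pref b n)/n → 0
SameFrequency : ∀ {k} → Word k → Fin k → Fin k → Set
SameFrequency s a b =
  FrequencyExists s a × FrequencyExists s b ×
  (∀ e → ∃[ N ] ∀ n → N ≤ n → suc e * ∣ pref s a n - pref s b n ∣ ≤ n)

{-# OPTIONS --safe #-}

-- An oddity arising from a palindrome that starts with a letter x starts and ends with x, so fewer than
-- |A| oddities leave a letter x such that every complete return to a palindrome starting with x is a
-- palindrome; this makes s closed under reversal.  By balance, a letter z with zz in s occurs in every
-- factor of length two ("z is separating").  If there is no square zz, the blocks between consecutive x's
-- are palindromes of one common odd length, and comparing letter counts of concentric windows shows that
-- two such blocks with centres a ≢ b differ only by exchanging a and b.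
-- If the two neighbours of some x are equal, to y say, repeated halving of the blocks shows that y is
-- separating.  Otherwise every x lies between the same two letters u and t, consecutive blocks are
-- exchanged by the transposition (u t), and u and t have the same frequency.
-- If y is separating, the word s′ of the letters that follow the occurrences of y in s inherits all
-- hypotheses, is never of the second kind (s would not be balanced), and two distinct right special
-- factors of equal length in s yield shorter ones in s′; by descent s is episturmian.
-- Only equality of words is at stake in the descent, so it may use the separating letter classically.
module Submission where

open import Defs
open import Data.Nat hiding (_≟_)
open import Data.Nat.Properties hiding (_≟_)
open import Data.Nat.Tactic.RingSolver using (solve-∀)
open import Data.Fin using (Fin)
open import Data.Fin.Properties using (_≟_; pigeonhole; ¬∀⟶∃¬) renaming (<⇒≢ to <⇒≢′)
open import Data.List using (List; []; _∷_; _++_; [_]; length; reverse; take; drop; lookup)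
open import Data.List.Properties using (≡-dec; ∷-injectiveˡ; ∷-injectiveʳ; ∷ʳ-injective; ++-assoc; ++-identityʳ; length-++; length-reverse; reverse-++; unfold-reverse)
import Data.List.Relation.Unary.Any as Any
open Any using (Any)
open import Data.List.Relation.Unary.Any.Properties using (lookup-index)
open import Data.Product using (∃-syntax; _×_; _,_; proj₁; proj₂)
open import Data.Sum using (_⊎_; inj₁; inj₂)
open import Data.Empty using (⊥; ⊥-elim)
open import Relation.Nullary using (¬_; Dec; yes; no)
open import Relation.Binary.Definitions using (tri<; tri≈; tri>)
open import Relation.Binary.PropositionalEquality hiding ([_])

-- Counting letters in windows

-- Whether `s` contains a square cannot be read off finitely many letters, so the final case
-- distinction is not made on it. It is made on `Alternates`, a decidable condition on one block
-- between two `x`'s and the letter after that block, which by balance already excludes squares. If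
-- it holds, two letters of equal frequency can be named; if it fails, it remains to refute pairs of
-- right special factors. The descent is measured by the length of `q` in a pair `a ∷ q`, `b ∷ q` of
-- right special factors with `a ≢ b`. A non-empty right special factor ends in `y`, and one of `a`,
-- `b` is not `y`, so `q` starts and ends with `y` and comes from a shorter word. The pair also
-- supplies the letter for the next round: if the letter `x` in use is `y` itself, its property
-- passes to every letter other than `y`, and `a` or `b` is such a letter and occurs in `s′`.

ind : ∀ {k} → Fin k → Fin k → ℕ
ind z w with w ≟ z
... | yes _ = 1
... | no  _ = 0

ind-hit : ∀ {k} {z w : Fin k} → w ≡ z → ind z w ≡ 1
ind-hit {z = z} {w} e with w ≟ z
... | yes _ = refl
... | no ne = ⊥-elim (ne e)

ind-miss : ∀ {k} {z w : Fin k} → w ≢ z → ind z w ≡ 0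
ind-miss {z = z} {w} ne with w ≟ z
... | yes e = ⊥-elim (ne e)
... | no _  = refl

ind≤1 : ∀ {k} (z w : Fin k) → ind z w ≤ 1
ind≤1 z w with w ≟ z
... | yes _ = ≤-refl
... | no _  = z≤n

module Counting {k} (s : Word k) where

  opaque
    C : Fin k → ℕ → ℕ → ℕ
    C z i n = occ z (sub s i n)

    C-occ : ∀ z i n → C z i n ≡ occ z (sub s i n)
    C-occ z i n = refl

    C-zero : ∀ z i → C z i 0 ≡ 0
    C-zero z i = refl

    C-suc : ∀ z i n → C z i (suc n) ≡ ind z (s i) + C z (suc i) n
    C-suc z i n with s i ≟ z
    ... | yes _ = refl
    ... | no _  = refl

  C-+ : ∀ z i m n → C z i (m + n) ≡ C z i m + C z (i + m) n
  C-+ z i zero    n = sym (cong₂ _+_ (C-zero z i) (cong (λ j → C z j n) (+-identityʳ i)))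
  C-+ z i (suc m) n = begin
    C z i (suc (m + n))                                    ≡⟨ C-suc z i (m + n) ⟩
    ind z (s i) + C z (suc i) (m + n)                      ≡⟨ cong (ind z (s i) +_) (C-+ z (suc i) m n) ⟩
    ind z (s i) + (C z (suc i) m + C z (suc i + m) n)      ≡⟨ +-assoc (ind z (s i)) _ _ ⟨
    ind z (s i) + C z (suc i) m + C z (suc i + m) n        ≡⟨ cong₂ _+_ (sym (C-suc z i m)) (cong (λ j → C z j n) (sym (+-suc i m))) ⟩
    C z i (suc m) + C z (i + suc m) n                      ∎
    where open ≡-Reasoning

  C-one : ∀ z i → C z i 1 ≡ ind z (s i)
  C-one z i = trans (C-suc z i 0) (trans (cong (ind z (s i) +_) (C-zero z (suc i))) (+-identityʳ _))

  C-snoc : ∀ z i n → C z i (suc n) ≡ C z i n + ind z (s (i + n))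
  C-snoc z i n = begin
    C z i (suc n)              ≡⟨ cong (C z i) (+-comm 1 n) ⟩
    C z i (n + 1)              ≡⟨ C-+ z i n 1 ⟩
    C z i n + C z (i + n) 1    ≡⟨ cong (C z i n +_) (C-one z (i + n)) ⟩
    C z i n + ind z (s (i + n)) ∎
    where open ≡-Reasoning

  C-≤ : ∀ z i n → C z i n ≤ n
  C-≤ z i zero = ≤-reflexive (C-zero z i)
  C-≤ z i (suc n) = ≤-trans (≤-reflexive (C-suc z i n)) (+-mono-≤ (ind≤1 z (s i)) (C-≤ z (suc i) n))

  C-mono : ∀ z i {m n} → m ≤ n → C z i m ≤ C z i n
  C-mono z i {m} {n} m≤n =
    ≤-trans (m≤m+n (C z i m) (C z (i + m) (n ∸ m)))
            (≤-reflexive (trans (sym (C-+ z i m (n ∸ m))) (cong (C z i) (m+[n∸m]≡n m≤n))))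

  C-none : ∀ z i n → (∀ j → j < n → s (i + j) ≢ z) → C z i n ≡ 0
  C-none z i zero    h = C-zero z i
  C-none z i (suc n) h = trans (C-snoc z i n)
    (cong₂ _+_ (C-none z i n (λ j j<n → h j (m<n⇒m<1+n j<n))) (ind-miss (h n (n<1+n n))))

  C-ends : ∀ z i n → C z i (2 + n) ≡ ind z (s i) + C z (suc i) n + ind z (s (i + suc n))
  C-ends z i n = trans (C-snoc z i (suc n)) (cong (_+ ind z (s (i + suc n))) (C-suc z i n))

  C-two : ∀ z i d → s i ≡ z → s (i + suc d) ≡ z → 2 ≤ C z i (2 + d)
  C-two z i d p q = begin
    2                                                   ≤⟨ m≤m+n 2 (C z (suc i) d) ⟩
    2 + C z (suc i) d                                   ≡⟨ +-comm 1 (suc (C z (suc i) d)) ⟩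
    1 + C z (suc i) d + 1                               ≡⟨ cong₂ (λ a b → a + C z (suc i) d + b) (sym (ind-hit p)) (sym (ind-hit q)) ⟩
    ind z (s i) + C z (suc i) d + ind z (s (i + suc d)) ≡⟨ C-ends z i d ⟨
    C z i (2 + d)                                       ∎
    where open ≤-Reasoning

  NoSquare : Set
  NoSquare = ∀ i → s i ≢ s (suc i)

  Separating : Fin k → Set
  Separating y = ∀ i → s i ≡ y ⊎ s (suc i) ≡ y

  module _ (bal : Balanced s) where

    C-bal : ∀ z i j n → C z i n ≤ suc (C z j n)
    C-bal z i j n = begin
      C z i n               ≡⟨ C-occ z i n ⟩
      occ z (sub s i n)     ≤⟨ bal i j n z ⟩
      occ z (sub s j n) + 1 ≡⟨ +-comm _ 1 ⟩
      suc (occ z (sub s j n)) ≡⟨ cong suc (C-occ z j n) ⟨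
      suc (C z j n)         ∎
      where open ≤-Reasoning

    -- Two `z`'s in one window of length `2 + d` leave no window of that length without `z`. Many of
    -- the contradictions below take this form.
    bal-gap : ∀ {z i j} d → s i ≡ z → s (i + suc d) ≡ z → (∀ n → n < 2 + d → s (j + n) ≢ z) → ⊥
    bal-gap {z} {i} {j} d p q h =
      1+n≰n (≤-trans (C-two z i d p q) (≤-trans (C-bal z i j (2 + d)) (≤-reflexive (cong suc (C-none z j (2 + d) h)))))

    square⇒separating : ∀ i → s i ≡ s (suc i) → Separating (s i)
    square⇒separating i e r with s r ≟ s i | s (suc r) ≟ s i
    ... | yes p | _     = inj₁ p
    ... | no _  | yes q = inj₂ q
    ... | no p  | no q  = ⊥-elim (bal-gap {i = i} {j = r} 0 refl (trans (cong s (+-comm i 1)) (sym e)) h)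
      where
      h : ∀ n → n < 2 → s (r + n) ≢ s i
      h 0 _ e = p (trans (cong s (sym (+-identityʳ r))) e)
      h 1 _ e = q (trans (cong s (+-comm 1 r)) e)
      h (suc (suc n)) (s≤s (s≤s ()))

    bal-gap3 : ∀ {z} i j → s i ≡ z → s (2 + i) ≡ z → s j ≢ z → s (1 + j) ≢ z → s (2 + j) ≢ z → ⊥
    bal-gap3 {z} i j p q h0 h1 h2 = bal-gap {i = i} {j = j} 1 p (trans (cong s (+-comm i 2)) q) h
      where
      h : ∀ n → n < 3 → s (j + n) ≢ z
      h 0 _ e = h0 (trans (cong s (sym (+-identityʳ j))) e)
      h 1 _ e = h1 (trans (cong s (+-comm 1 j)) e)
      h 2 _ e = h2 (trans (cong s (+-comm 2 j)) e)
      h (suc (suc (suc n))) (s≤s (s≤s (s≤s ())))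

-- Pairs of odd palindromes in a balanced word without squares

-- `d` is the image of `c` under the transposition of `α` and `β`.
Exchanged : ∀ {k} → Fin k → Fin k → Fin k → Fin k → Set
Exchanged α β c d = (c ≡ d × c ≢ α × c ≢ β) ⊎ (c ≡ α × d ≡ β) ⊎ (c ≡ β × d ≡ α)

exchanged-comm : ∀ {k} {α β c d : Fin k} → Exchanged α β c d → Exchanged β α c d
exchanged-comm (inj₁ (e , na , nb)) = inj₁ (e , nb , na)
exchanged-comm (inj₂ (inj₁ h))      = inj₂ (inj₂ h)
exchanged-comm (inj₂ (inj₂ h))      = inj₂ (inj₁ h)

module Pairs {k} (s : Word k) (bal : Balanced s) where
  open Counting s

  -- A palindrome of odd length `suc (m + m)` starting at `i`, hence with centre `i + m`.
  Pal : ℕ → ℕ → Set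
  Pal i m = ∀ n n′ → n + n′ ≡ m + m → s (i + n) ≡ s (i + n′)

  Pal-inner : ∀ {i m R r} → Pal i m → R + r ≡ m → Pal (i + r) R
  Pal-inner {i} {R = R} {r} pal refl n n′ eq =
    trans (cong s (+-assoc i r n)) (trans (pal (r + n) (r + n′) (trans (lem r n n′) (trans (cong (λ x → r + (r + x)) eq) (lem′ r R))))
      (cong s (sym (+-assoc i r n′))))
    where
    lem : ∀ r n n′ → r + n + (r + n′) ≡ r + (r + (n + n′))
    lem = solve-∀
    lem′ : ∀ r R → r + (r + (R + R)) ≡ R + r + (R + r)
    lem′ = solve-∀

  -- Occurrences of z in the window of radius n centred at i + j + n.
  K : Fin k → ℕ → ℕ → ℕ → ℕ
  K z i j n = C z (i + j) (suc (n + n))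

  -- Last index of the window of radius `suc n` that starts at `j`: the mirror image of `j` when
  -- `j + suc n ≡ m`.
  lastIx : ℕ → ℕ → ℕ
  lastIx j n = j + suc (suc (n + n))

  last-mirror : ∀ {m} j n → j + suc n ≡ m → lastIx j n + j ≡ m + m
  last-mirror j n refl = lem j n
    where
    lem : ∀ j n → j + suc (suc (n + n)) + j ≡ (j + suc n) + (j + suc n)
    lem = solve-∀

  K-ends : ∀ z i j n → K z i j (suc n) ≡ ind z (s (i + j)) + K z i (suc j) n + ind z (s (i + lastIx j n))
  K-ends z i j n = begin
    C z (i + j) (suc (suc n + suc n))  ≡⟨ cong (λ l → C z (i + j) (suc (suc l))) (+-suc n n) ⟩
    C z (i + j) (2 + suc (n + n))      ≡⟨ C-ends z (i + j) (suc (n + n)) ⟩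
    ind z (s (i + j)) + C z (suc (i + j)) (suc (n + n)) + ind z (s (i + j + suc (suc (n + n))))
      ≡⟨ cong₂ (λ a b → ind z (s (i + j)) + C z a (suc (n + n)) + ind z (s b)) (sym (+-suc i j)) (+-assoc i j _) ⟩
    ind z (s (i + j)) + K z i (suc j) n + ind z (s (i + lastIx j n)) ∎
    where open ≡-Reasoning

  K-hit : ∀ z i j n → s (i + j) ≡ z → s (i + lastIx j n) ≡ z → K z i j (suc n) ≡ 2 + K z i (suc j) n
  K-hit z i j n p q = trans (K-ends z i j n)
    (trans (cong₂ (λ a b → a + K z i (suc j) n + b) (ind-hit p) (ind-hit q)) (+-comm (suc (K z i (suc j) n)) 1))

  K-miss : ∀ z i j n → s (i + j) ≢ z → s (i + lastIx j n) ≢ z → K z i j (suc n) ≡ K z i (suc j) n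
  K-miss z i j n p q = trans (K-ends z i j n)
    (trans (cong₂ (λ a b → a + K z i (suc j) n + b) (ind-miss p) (ind-miss q)) (+-identityʳ _))

  K-bal : ∀ z i i′ j j′ n → K z i j n ≤ suc (K z i′ j′ n)
  K-bal z i i′ j j′ n = C-bal bal z (i + j) (i′ + j′) (suc (n + n))

  -- Widening by one letter on each side adds two `z`'s to one window and none to the other. Unless
  -- the other was ahead before, the counts now differ by two.
  K-clash : ∀ z i i′ j j′ n → s (i + j) ≡ z → s (i + lastIx j n) ≡ z → s (i′ + j′) ≢ z → s (i′ + lastIx j′ n) ≢ z →
            K z i′ (suc j′) n ≤ K z i (suc j) n → ⊥
  K-clash z i i′ j j′ n p q p′ q′ le = 1+n≰n (≤-trans (s≤s (s≤s le))
    (subst₂ (λ a b → a ≤ suc b) (K-hit z i j n p q) (K-miss z i′ j′ n p′ q′) (K-bal z i i′ j j′ (suc n))))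

  -- Compares the windows of radius n starting at i + j and i′ + j.
  record Offset (α β : Fin k) (i i′ j n : ℕ) : Set where
    constructor offset
    field
      over  : K α i j n ≡ suc (K α i′ j n)
      under : K β i′ j n ≡ suc (K β i j n)
      level : ∀ z → z ≢ α → z ≢ β → K z i j n ≡ K z i′ j n

  open Offset public

  -- The possible effects of widening two concentric windows by one letter on each side. In a swap
  -- the first window, one `β` behind, gains two and is then one ahead; likewise the second with
  -- `α`. So the surplus changes hands.
  data Step (α β : Fin k) (i i′ j n : ℕ) : Set where
    same : s (i + j) ≡ s (i′ + j) → s (i + j) ≢ α → s (i + j) ≢ β → Offset α β i i′ j (suc n) → Step α β i i′ j n
    swap : s (i + j) ≡ β → s (i′ + j) ≡ α → Offset β α i i′ j (suc n) → Step α β i i′ j n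

  module _ (nosq : NoSquare) where

    -- Dropping two letters on the right of the larger window loses only one α, as αα does not occur.
    no-growth : ∀ {α i i′ j n} → K α i (suc j) n ≡ suc (K α i′ (suc j) n) →
                s (i + j) ≡ α → s (i + lastIx j n) ≡ α → ⊥
    no-growth {α} {i} {i′} {j} {n} ov p q = 1+n≰n (≤-trans (≤-reflexive eq) (K-bal α i i′ j (suc j) n))
      where
      open ≡-Reasoning
      q′ : s (suc (i + j + suc (n + n))) ≡ α
      q′ = trans (cong s (lem i j n)) q
        where
        lem : ∀ i j n → suc (i + j + suc (n + n)) ≡ i + (j + suc (suc (n + n)))
        lem = solve-∀
      eq : suc (suc (K α i′ (suc j) n)) ≡ K α i j n
      eq = suc-injective (begin
        suc (suc (suc (K α i′ (suc j) n))) ≡⟨ cong (2 +_) (sym ov) ⟩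
        2 + K α i (suc j) n                ≡⟨ sym (K-hit α i j n p q) ⟩
        C α (i + j) (suc (suc n + suc n))  ≡⟨ cong (λ l → C α (i + j) (suc (suc l))) (+-suc n n) ⟩
        C α (i + j) (suc (suc (suc (n + n)))) ≡⟨ C-snoc α (i + j) (suc (suc (n + n))) ⟩
        C α (i + j) (suc (suc (n + n))) + ind α (s (i + j + suc (suc (n + n))))
          ≡⟨ cong₂ _+_ (C-snoc α (i + j) (suc (n + n))) (ind-hit (trans (cong s (+-suc (i + j) _)) q′)) ⟩
        K α i j n + ind α (s (i + j + suc (n + n))) + 1
          ≡⟨ cong (λ a → K α i j n + a + 1) (ind-miss (λ e → nosq _ (trans e (sym q′)))) ⟩
        K α i j n + 0 + 1 ≡⟨ cong (_+ 1) (+-identityʳ _) ⟩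
        K α i j n + 1 ≡⟨ +-comm _ 1 ⟩
        suc (K α i j n) ∎)

    module _ {m i i′} (pal : Pal i m) (pal′ : Pal i′ m) where

      last≡ : ∀ {j n} → j + suc n ≡ m → s (i + lastIx j n) ≡ s (i + j)
      last≡ {j} {n} e = pal (lastIx j n) j (last-mirror j n e)

      last≡′ : ∀ {j n} → j + suc n ≡ m → s (i′ + lastIx j n) ≡ s (i′ + j)
      last≡′ {j} {n} e = pal′ (lastIx j n) j (last-mirror j n e)

      hitL : ∀ {z j n} → j + suc n ≡ m → s (i + j) ≡ z → K z i j (suc n) ≡ 2 + K z i (suc j) n
      hitL e p = K-hit _ i _ _ p (trans (last≡ e) p)

      hitR : ∀ {z j n} → j + suc n ≡ m → s (i′ + j) ≡ z → K z i′ j (suc n) ≡ 2 + K z i′ (suc j) n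
      hitR e p = K-hit _ i′ _ _ p (trans (last≡′ e) p)

      missL : ∀ {z j n} → j + suc n ≡ m → s (i + j) ≢ z → K z i j (suc n) ≡ K z i (suc j) n
      missL e p = K-miss _ i _ _ p (λ x → p (trans (sym (last≡ e)) x))

      missR : ∀ {z j n} → j + suc n ≡ m → s (i′ + j) ≢ z → K z i′ j (suc n) ≡ K z i′ (suc j) n
      missR e p = K-miss _ i′ _ _ p (λ x → p (trans (sym (last≡′ e)) x))

      clashL : ∀ {z j n} → j + suc n ≡ m → s (i + j) ≡ z → s (i′ + j) ≢ z → K z i′ (suc j) n ≤ K z i (suc j) n → ⊥
      clashL {z} {j} {n} e p p′ = K-clash z i i′ j j n p (trans (last≡ e) p) p′ (λ x → p′ (trans (sym (last≡′ e)) x))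

      clashR : ∀ {z j n} → j + suc n ≡ m → s (i + j) ≢ z → s (i′ + j) ≡ z → K z i (suc j) n ≤ K z i′ (suc j) n → ⊥
      clashR {z} {j} {n} e p p′ = K-clash z i′ i j j n p′ (trans (last≡′ e) p′) p (λ x → p (trans (sym (last≡ e)) x))

      -- A letter that ends only one of the windows is gained twice there, which balance permits
      -- only to a window that was behind in it: this is `β` for the first and `α` for the second.
      -- If the letters coincide, `no-growth` excludes `α` and `β`.
      step : ∀ {α β} j n → j + suc n ≡ m → α ≢ β → Offset α β i i′ (suc j) n → Step α β i i′ j n
      step {α} {β} j n e α≢β (offset ov un lv) with s (i + j) ≟ s (i′ + j)
      ... | yes eq = same eq nα nβ (offset
              (trans (missL e nα) (trans ov (cong suc (sym (missR e nα′)))))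
              (trans (missR e nβ′) (trans un (cong suc (sym (missL e nβ)))))
              lv′)
        where
        nα : s (i + j) ≢ α
        nα p = no-growth {i = i} {i′} {j} {n} ov p (trans (last≡ e) p)
        nβ′ : s (i′ + j) ≢ β
        nβ′ p = no-growth {i = i′} {i} {j} {n} un p (trans (last≡′ e) p)
        nβ : s (i + j) ≢ β
        nβ p = nβ′ (trans (sym eq) p)
        nα′ : s (i′ + j) ≢ α
        nα′ p = nα (trans eq p)
        lv′ : ∀ z → z ≢ α → z ≢ β → K z i j (suc n) ≡ K z i′ j (suc n)
        lv′ z za zb with s (i + j) ≟ z
        ... | yes p = trans (hitL e p) (trans (cong (2 +_) (lv z za zb)) (sym (hitR e (trans (sym eq) p))))
        ... | no p  = trans (missL e p) (trans (lv z za zb) (sym (missR e (λ x → p (trans eq x)))))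
      ... | no ne = swap isβ isα (offset
              (trans (hitL e isβ) (cong suc (trans (sym un) (sym (missR e n1)))))
              (trans (hitR e isα) (cong suc (trans (sym ov) (sym (missL e n2)))))
              lv′)
        where
        isβ : s (i + j) ≡ β
        isβ with s (i + j) ≟ β
        ... | yes p = p
        ... | no p  = ⊥-elim (clashL e refl (λ x → ne (sym x)) le)
          where
          le : K (s (i + j)) i′ (suc j) n ≤ K (s (i + j)) i (suc j) n
          le with s (i + j) ≟ α
          ... | yes a = subst (λ z → K z i′ (suc j) n ≤ K z i (suc j) n) (sym a) (≤-trans (n≤1+n _) (≤-reflexive (sym ov)))
          ... | no a  = ≤-reflexive (sym (lv _ a p))
        isα : s (i′ + j) ≡ α
        isα with s (i′ + j) ≟ α
        ... | yes p = p
        ... | no p  = ⊥-elim (clashR e ne refl le)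
          where
          le : K (s (i′ + j)) i (suc j) n ≤ K (s (i′ + j)) i′ (suc j) n
          le with s (i′ + j) ≟ β
          ... | yes b = subst (λ z → K z i (suc j) n ≤ K z i′ (suc j) n) (sym b) (≤-trans (n≤1+n _) (≤-reflexive (sym un)))
          ... | no b  = ≤-reflexive (lv _ p b)
        n1 : s (i′ + j) ≢ β
        n1 x = α≢β (trans (sym isα) x)
        n2 : s (i + j) ≢ α
        n2 x = α≢β (trans (sym x) isβ)
        lv′ : ∀ z → z ≢ β → z ≢ α → K z i j (suc n) ≡ K z i′ j (suc n)
        lv′ z zb za = trans (missL e (λ x → zb (trans (sym x) isβ)))
          (trans (lv z za zb) (sym (missR e (λ x → za (trans (sym x) isα)))))

      private
        a b : Fin k
        a = s (i + m)
        b = s (i′ + m)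

      start-offset : a ≢ b → Offset a b i i′ m 0
      start-offset a≢b = offset
        (trans (trans (C-one a _) (ind-hit refl)) (cong suc (sym (trans (C-one a _) (ind-miss (λ x → a≢b (sym x)))))))
        (trans (trans (C-one b _) (ind-hit refl)) (cong suc (sym (trans (C-one b _) (ind-miss a≢b)))))
        (λ z za zb → trans (trans (C-one z _) (ind-miss (λ x → za (sym x)))) (sym (trans (C-one z _) (ind-miss (λ x → zb (sym x))))))

      polarity : a ≢ b → ∀ n j → j + n ≡ m → Offset a b i i′ j n ⊎ Offset b a i i′ j n
      polarity a≢b zero j e = inj₁ (subst (λ j → Offset a b i i′ j 0) (trans (sym e) (+-identityʳ j)) (start-offset a≢b))
      polarity a≢b (suc n) j e with polarity a≢b n (suc j) (trans (sym (+-suc j n)) e)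
      ... | inj₁ o with step j n e a≢b o
      ...   | same _ _ _ o′ = inj₁ o′
      ...   | swap _ _ o′   = inj₂ o′
      polarity a≢b (suc n) j e | inj₂ o with step j n e (λ x → a≢b (sym x)) o
      ...   | same _ _ _ o′ = inj₂ o′
      ...   | swap _ _ o′   = inj₁ o′

      -- One of the two polarities holds at every radius, and under either of them `step` admits
      -- only pairs that the transposition of the centres allows.
      swapped : a ≢ b → ∀ n j → j + n ≡ m → Exchanged a b (s (i + j)) (s (i′ + j))
      swapped a≢b zero j e = inj₂ (inj₁ (cong (λ j → s (i + j)) j≡m , cong (λ j → s (i′ + j)) j≡m))
        where
        j≡m : j ≡ m
        j≡m = trans (sym (+-identityʳ j)) e
      swapped a≢b (suc n) j e with polarity a≢b n (suc j) (trans (sym (+-suc j n)) e)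
      ... | inj₁ o with step j n e a≢b o
      ...   | same eq na nb _ = inj₁ (eq , na , nb)
      ...   | swap p q _      = inj₂ (inj₂ (p , q))
      swapped a≢b (suc n) j e | inj₂ o with step j n e (λ x → a≢b (sym x)) o
      ...   | same eq nb na _ = inj₁ (eq , na , nb)
      ...   | swap p q _      = inj₂ (inj₁ (p , q))

      next-to-centre : a ≢ b → ∀ j → suc j ≡ m →
        (s (i + j) ≡ s (i′ + j) × s (i + j) ≢ a × s (i + j) ≢ b) ⊎ (s (i + j) ≡ b × s (i′ + j) ≡ a)
      next-to-centre a≢b j refl with step j 0 (+-comm j 1) a≢b (start-offset a≢b)
      ... | same eq na nb _ = inj₁ (eq , na , nb)
      ... | swap p q _      = inj₂ (p , q)

      -- The polarity changes only at a swap, and a swap sets different letters opposite each other.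
      aligned : a ≢ b → ∀ n j → j + n ≡ m → (∀ l → j ≤ l → l < m → s (i + l) ≡ s (i′ + l)) → Offset a b i i′ j n
      aligned a≢b zero j e h = subst (λ j → Offset a b i i′ j 0) (trans (sym e) (+-identityʳ j)) (start-offset a≢b)
      aligned a≢b (suc n) j e h
        with step j n e a≢b (aligned a≢b n (suc j) (trans (sym (+-suc j n)) e) (λ l j<l → h l (<⇒≤ j<l)))
      ... | same _ _ _ o = o
      ... | swap p q _   = ⊥-elim (a≢b (trans (sym q) (trans (sym (h j ≤-refl (≤-trans (m<m+n j z<s) (≤-reflexive e)))) p)))

      -- Equal counts persist as the windows grow: a letter that ended only one of them would put it
      -- two ahead.
      equal-centres : a ≡ b → ∀ n j → j + n ≡ m → s (i + j) ≡ s (i′ + j) × (∀ z → K z i j n ≡ K z i′ j n)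
      equal-centres a≡b zero j e = eq , λ z → trans (C-one z _) (trans (cong (ind z) eq) (sym (C-one z _)))
        where
        j≡m : j ≡ m
        j≡m = trans (sym (+-identityʳ j)) e
        eq : s (i + j) ≡ s (i′ + j)
        eq = trans (cong (λ j → s (i + j)) j≡m) (trans a≡b (cong (λ j → s (i′ + j)) (sym j≡m)))
      equal-centres a≡b (suc n) j e with equal-centres a≡b n (suc j) (trans (sym (+-suc j n)) e) | s (i + j) ≟ s (i′ + j)
      ... | _ , lv | no ne  = ⊥-elim (clashL {n = n} e refl (λ x → ne (sym x)) (≤-reflexive (sym (lv _))))
      ... | _ , lv | yes eq = eq , lv′
        where
        lv′ : ∀ z → K z i j (suc n) ≡ K z i′ j (suc n)
        lv′ z with s (i + j) ≟ z
        ... | yes p = trans (hitL e p) (trans (cong (2 +_) (lv z)) (sym (hitR e (trans (sym eq) p))))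
        ... | no p  = trans (missL e p) (trans (lv z) (sym (missR e (λ x → p (trans eq x)))))

-- Halving a comb of palindromic blocks

data Halving : ℕ → Set where
  even : ∀ h → Halving (h + h)
  odd  : ∀ h → Halving (suc (h + h))

halving : ∀ n → Halving n
halving zero = even 0
halving (suc n) with halving n
... | even h = odd h
... | odd h  = subst Halving (cong suc (+-suc h h)) (even (suc h))

module Descent {k} (s : Word k) (bal : Balanced s) (nosq : Counting.NoSquare s) where
  open Counting s
  open Pairs s bal

  -- The two delimiting letters, at `p` and `p + suc N`, need not be equal: after a halving, one of
  -- them is the centre of an older block.
  record Block (N p : ℕ) : Set where
    field
      pal   : ∀ n n′ → suc (n + n′) ≡ N → s (suc p + n) ≡ s (suc p + n′)
      freshˡ : ∀ j → j < N → s (suc p + j) ≢ s p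
      freshʳ : ∀ j → j < N → s (suc p + j) ≢ s (p + suc N)

  open Block

  at : ∀ {x y} → x ≡ y → s x ≡ s y
  at = cong s

  module Neighbours {m p} (B : Block (suc (m + m)) p) (B′ : Block (suc (m + m)) (p + suc (suc (m + m)))) where

    q : ℕ
    q = p + suc (suc (m + m))

    F G : ℕ → Fin k
    F j = s (suc p + j)
    G j = s (suc q + j)

    palF : Pal (suc p) m
    palF n n′ e = pal B n n′ (cong suc e)

    palG : Pal (suc q) m
    palG n n′ e = pal B′ n n′ (cong suc e)

    X : Fin k
    X = s q

    F≢X : ∀ j → j ≤ m + m → F j ≢ X
    F≢X j le = freshʳ B j (s≤s le)

    G≢X : ∀ j → j ≤ m + m → G j ≢ X
    G≢X j le = freshˡ B′ j (s≤s le)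

    -- Read outwards from `X`, the left side is `F 0`, `F 1`, ... because `F` is a palindrome, and
    -- the right side is `G 0`, `G 1`, .... Where these agree, the window about `X` is itself a
    -- palindrome, to be compared with the central windows of `F` and of `G`. It starts at `iq`.
    module Around {R r} (e : R + r ≡ m) (agree : ∀ j → j < R → F j ≡ G j) where

      iq : ℕ
      iq = suc p + (suc m + r)

      left : ∀ n d → suc (n + d) ≡ R → s (iq + n) ≡ F d
      left n d refl = trans (at (+-assoc (suc p) (suc m + r) n)) (palF (suc m + r + n) d (trans (lem m r n d) (cong (m +_) e)))
        where
        lem : ∀ m r n d → suc m + r + n + d ≡ m + (suc (n + d) + r)
        lem = solve-∀

      right : ∀ n d → n ≡ suc (R + d) → s (iq + n) ≡ G d
      right .(suc (R + d)) d refl = at (trans (lem p m r R d) (cong (λ l → suc (p + suc (suc (m + l)) + d)) e))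
        where
        lem : ∀ p m r R d → suc p + (suc m + r) + suc (R + d) ≡ suc (p + suc (suc (m + (R + r))) + d)
        lem = solve-∀

      centre : s (iq + R) ≡ X
      centre = at (trans (lem p m r R) (cong (λ l → p + suc (suc (m + l))) e))
        where
        lem : ∀ p m r R → suc p + (suc m + r) + R ≡ p + suc (suc (m + (R + r)))
        lem = solve-∀

      palQ-< : ∀ n n′ → n < R → n + n′ ≡ R + R → s (iq + n) ≡ s (iq + n′)
      palQ-< n n′ n<R eq = trans (left n d d-eq) (trans (agree d d<R) (sym (right n′ d n′-eq)))
        where
        d = R ∸ suc n
        d-eq : suc n + d ≡ R
        d-eq = m+[n∸m]≡n n<R
        d<R : d < R
        d<R = ≤-trans (s≤s (m≤n+m d n)) (≤-reflexive d-eq)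
        lem : ∀ n d R → n + suc (R + d) ≡ (suc n + d) + R
        lem = solve-∀
        n′-eq : n′ ≡ suc (R + d)
        n′-eq = +-cancelˡ-≡ n n′ _ (trans eq (trans (cong (_+ R) (sym d-eq)) (sym (lem n d R))))

      palQ : Pal iq R
      palQ n n′ eq with <-cmp n R
      ... | tri< n<R _ _ = palQ-< n n′ n<R eq
      ... | tri≈ _ refl _ = at (cong (iq +_) (sym (+-cancelˡ-≡ n n′ n eq)))
      ... | tri> _ _ n>R = sym (palQ-< n′ n (+-cancelˡ-< n n′ R (≤-trans (≤-reflexive (cong suc eq)) (+-monoˡ-< R n>R)))
                                        (trans (+-comm n′ n) eq))

      palFr : Pal (suc p + r) R
      palFr = Pal-inner palF e

      palGr : Pal (suc q + r) R
      palGr = Pal-inner palG e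

      F-centre : s (suc p + r + R) ≡ F m
      F-centre = at (trans (+-assoc (suc p) r R) (cong (suc p +_) (trans (+-comm r R) e)))

      G-centre : s (suc q + r + R) ≡ G m
      G-centre = at (trans (+-assoc (suc q) r R) (cong (suc q +_) (trans (+-comm r R) e)))

      r+l≤ : ∀ l → l ≤ R → r + l ≤ m + m
      r+l≤ l l≤R = ≤-trans (+-monoʳ-≤ r l≤R) (≤-trans (≤-reflexive (trans (+-comm r R) e)) (m≤m+n m m))

      X≢Fm : s (iq + R) ≢ s (suc p + r + R)
      X≢Fm x = F≢X m (m≤m+n m m) (sym (trans (sym centre) (trans x F-centre)))

      X≢Gm : s (iq + R) ≢ s (suc q + r + R)
      X≢Gm x = G≢X m (m≤m+n m m) (sym (trans (sym centre) (trans x G-centre)))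

      d<R⇒ : ∀ {l d} → suc (l + d) ≡ R → d < R
      d<R⇒ {l} {d} eq = ≤-trans (s≤s (m≤n+m d l)) (≤-reflexive eq)

      l<R⇒ : ∀ {l d} → suc (l + d) ≡ R → l < R
      l<R⇒ {l} {d} eq = ≤-trans (s≤s (m≤m+n l d)) (≤-reflexive eq)

      d≤2m : ∀ {l d} → suc (l + d) ≡ R → d ≤ m + m
      d≤2m {l} {d} eq = ≤-trans (<⇒≤ (d<R⇒ {l} eq)) (≤-trans (≤-trans (m≤m+n R r) (≤-reflexive e)) (m≤m+n m m))

      splitR : ∀ {l d} → suc (l + d) ≡ R → l + suc d ≡ R
      splitR {l} {d} eq = trans (+-suc l d) eq

      -- The centres compared are `X` and `F m`, so by `swapped` a difference off the centre would
      -- put an `X` there in one of the two windows; neither has one.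
      Q≡F : ∀ l d → suc (l + d) ≡ R → s (iq + l) ≡ s (suc p + r + l) × s (iq + l) ≢ F m
      Q≡F l d eq with swapped nosq palQ palFr X≢Fm (suc d) l (splitR eq)
      ... | inj₁ (x , _ , n) = x , λ y → n (trans y (sym F-centre))
      ... | inj₂ (inj₁ (x , _)) = ⊥-elim (F≢X d (d≤2m eq) (trans (sym (left l d eq)) (trans x centre)))
      ... | inj₂ (inj₂ (_ , x)) =
            ⊥-elim (F≢X (r + l) (r+l≤ l (<⇒≤ (l<R⇒ eq))) (trans (at (sym (+-assoc (suc p) r l))) (trans x centre)))

      Q≡G : ∀ l d → suc (l + d) ≡ R → s (iq + l) ≡ s (suc q + r + l)
      Q≡G l d eq with swapped nosq palQ palGr X≢Gm (suc d) l (splitR eq)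
      ... | inj₁ (x , _ , _) = x
      ... | inj₂ (inj₁ (x , _)) = ⊥-elim (F≢X d (d≤2m eq) (trans (sym (left l d eq)) (trans x centre)))
      ... | inj₂ (inj₂ (_ , x)) =
            ⊥-elim (G≢X (r + l) (r+l≤ l (<⇒≤ (l<R⇒ eq))) (trans (at (sym (+-assoc (suc q) r l))) (trans x centre)))

      levelG : ∀ z → z ≢ X → z ≢ G m → C z iq (suc (R + R)) ≡ C z (suc q + r) (suc (R + R))
      levelG z zX zG = trans (cong (λ l → C z l (suc (R + R))) (sym (+-identityʳ iq)))
        (trans (level (aligned nosq palQ palGr X≢Gm R 0 refl agreeG) z (λ x → zX (trans x centre)) (λ x → zG (trans x G-centre)))
               (cong (λ l → C z l (suc (R + R))) (+-identityʳ (suc q + r))))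
        where
        agreeG : ∀ l → 0 ≤ l → l < R → s (iq + l) ≡ s (suc q + r + l)
        agreeG l _ l<R = Q≡G l (R ∸ suc l) (m+[n∸m]≡n l<R)

      -- The window about `X` carries agreement on the first `R` letters over to the `R` letters
      -- just before the centres.
      F≡G-inner : ∀ l → l < R → F (r + l) ≡ G (r + l)
      F≡G-inner l l<R = trans (at (sym (+-assoc (suc p) r l)))
        (trans (sym (proj₁ (Q≡F l (R ∸ suc l) (m+[n∸m]≡n l<R))))
        (trans (Q≡G l (R ∸ suc l) (m+[n∸m]≡n l<R)) (at (+-assoc (suc q) r l))))

    module FirstDifference {R r′} (e : R + suc r′ ≡ m) (agree : ∀ j → j < R → F j ≡ G j)
                           (differ : F R ≢ G R) (a≢b : F m ≢ G m) where

      open Around e agree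

      a b : Fin k
      a = F m
      b = G m

      Swap : ℕ → Set
      Swap j = (F j ≡ a × G j ≡ b) ⊎ (F j ≡ b × G j ≡ a)

      swap-at : ∀ j n → j + n ≡ m → F j ≢ G j → Swap j
      swap-at j n eq ne with swapped nosq palF palG a≢b n j eq
      ... | inj₁ (x , _) = ⊥-elim (ne x)
      ... | inj₂ x       = x

      swap-avoids : ∀ {j z} → Swap j → z ≢ a → z ≢ b → F j ≢ z × G j ≢ z
      swap-avoids (inj₁ (x , y)) za zb = (λ w → za (trans (sym w) x)) , (λ w → zb (trans (sym w) y))
      swap-avoids (inj₂ (x , y)) za zb = (λ w → zb (trans (sym w) x)) , (λ w → za (trans (sym w) y))

      e₁ : r′ + suc R ≡ m
      e₁ = trans (trans (+-suc r′ R) (+-comm (suc r′) R)) e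

      swapR : Swap R
      swapR = swap-at R _ e differ

      iq₁ : ℕ
      iq₁ = suc p + (suc m + r′)

      iq₁≡ : suc iq₁ ≡ iq
      iq₁≡ = lem p m r′
        where
        lem : ∀ p m r → suc (suc p + (suc m + r)) ≡ suc p + (suc m + suc r)
        lem = solve-∀

      mirrorF : ∀ j d n → j + suc d ≡ m → n ≡ suc m + j → s (suc p + n) ≡ F d
      mirrorF j d n refl refl = palF _ d (lem j d)
        where
        lem : ∀ j d → suc (j + suc d) + j + d ≡ j + suc d + (j + suc d)
        lem = solve-∀

      iq₁-left : s (iq₁ + 0) ≡ F R
      iq₁-left = trans (at (+-identityʳ iq₁)) (mirrorF r′ R _ e₁ refl)

      iq₁-right : s (iq₁ + lastIx 0 R) ≡ G R
      iq₁-right = trans (at (trans (+-suc iq₁ _) (cong (_+ suc (R + R)) iq₁≡))) (right _ R refl)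

      lastG : ∀ j n → j + suc n ≡ m → s (suc q + j + lastIx 0 n) ≡ G j
      lastG j n eq = trans (at (+-assoc (suc q) j _)) (palG (lastIx j n) j (last-mirror j n eq))

      lastF : ∀ j n → j + suc n ≡ m → s (suc p + j + lastIx 0 n) ≡ F j
      lastF j n eq = trans (at (+-assoc (suc p) j _)) (palF (lastIx j n) j (last-mirror j n eq))

      firstG : ∀ j → s (suc q + j + 0) ≡ G j
      firstG j = at (+-identityʳ (suc q + j))

      level₁ : ∀ z → z ≢ X → z ≢ b → K z iq₁ 1 R ≡ K z (suc q + r′) 1 R
      level₁ z zX zb = trans (cong (λ l → C z l (suc (R + R))) (trans (+-comm iq₁ 1) iq₁≡))
        (trans (levelG z zX zb) (cong (λ l → C z l (suc (R + R))) (lem q r′)))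
        where
        lem : ∀ q r → suc q + suc r ≡ suc q + r + 1
        lem = solve-∀

      G≢X′ : ∀ {j n} → j + n ≡ m → G j ≢ X
      G≢X′ {j} {n} eq = G≢X j (≤-trans (m≤m+n j n) (≤-trans (≤-reflexive eq) (m≤m+n m m)))

      -- The ends of the window of radius `suc R` about `X` are `a` and `b`. With any other letter
      -- at `r′`, the central window of `G` would gain two of that letter against none, from equal
      -- counts.
      no-same₁ : G r′ ≢ a → G r′ ≢ b → ⊥
      no-same₁ na nb = K-clash z (suc q + r′) iq₁ 0 0 R (firstG r′) (lastG r′ R e₁)
          (λ x → proj₁ av (trans (sym iq₁-left) x)) (λ x → proj₂ av (trans (sym iq₁-right) x))
          (≤-reflexive (level₁ z (G≢X′ e₁) nb))
        where
        z = G r′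
        av = swap-avoids swapR na nb

      -- Up to radius `R` the blocks differ only in their centres, so the surplus is still `a` for
      -- `F` and `b` for `G`; of the two outcomes of `step`, `no-same₁` leaves the swap.
      offset₁ : F r′ ≡ b × G r′ ≡ a × Offset b a (suc p) (suc q) r′ (suc R)
      offset₁ with step nosq palF palG r′ R e₁ a≢b
                     (aligned nosq palF palG a≢b R (suc r′) (trans (+-comm (suc r′) R) e) inner)
        where
        inner : ∀ l → suc r′ ≤ l → l < m → F l ≡ G l
        inner l le lt = subst (λ l → F l ≡ G l) (m+[n∸m]≡n le)
          (F≡G-inner (l ∸ suc r′) (+-cancelˡ-< (suc r′) _ R
            (≤-trans (≤-reflexive (cong suc (m+[n∸m]≡n le))) (≤-trans lt (≤-reflexive (sym (trans (+-comm (suc r′) R) e)))))))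
      ... | same x na nb _ = ⊥-elim (no-same₁ (λ w → na (trans x w)) (λ w → nb (trans x w)))
      ... | swap x y o     = x , y , o

    module Conflict {R r″} (e : R + suc (suc r″) ≡ m) (R>0 : 0 < R) (agree : ∀ j → j < R → F j ≡ G j)
                    (differ : F R ≢ G R) (a≢b : F m ≢ G m) where

      open FirstDifference e agree differ a≢b
      open Around e agree

      r′ : ℕ
      r′ = suc r″

      e₂ : r″ + suc (suc R) ≡ m
      e₂ = trans (+-suc r″ (suc R)) e₁

      iq₂ : ℕ
      iq₂ = suc p + (suc m + r″)

      iq₂≡ : suc iq₂ ≡ iq₁
      iq₂≡ = lem p m r″
        where
        lem : ∀ p m r → suc (suc p + (suc m + r)) ≡ suc p + (suc m + suc r)
        lem = solve-∀

      iq₂-left : s (iq₂ + 0) ≡ F (suc R)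
      iq₂-left = trans (at (+-identityʳ iq₂)) (mirrorF r″ (suc R) _ e₂ refl)

      iq₂-right : s (iq₂ + lastIx 0 (suc R)) ≡ G (suc R)
      iq₂-right = trans (at (trans (lem iq₂ R) (cong (_+ suc (R + suc R)) (trans (cong suc iq₂≡) iq₁≡)))) (right _ (suc R) refl)
        where
        lem : ∀ i R → i + suc (suc (suc R + suc R)) ≡ suc (suc i) + suc (R + suc R)
        lem = solve-∀

      level₂ : ∀ z → z ≢ X → z ≢ a → z ≢ b → K z iq₂ 1 (suc R) ≡ K z (suc q + r″) 1 (suc R)
      level₂ z zX za zb = trans (cong (λ l → C z l (suc (suc R + suc R))) (trans (+-comm iq₂ 1) (trans iq₂≡ (sym (+-identityʳ iq₁)))))
        (trans (K-miss z iq₁ 0 R (λ x → proj₁ av (trans (sym iq₁-left) x)) (λ x → proj₂ av (trans (sym iq₁-right) x)))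
        (trans (level₁ z zX zb)
        (trans (sym (K-miss z (suc q + r′) 0 R (λ x → nG (trans (sym (firstG r′)) x)) (λ x → nG (trans (sym (lastG r′ R e₁)) x))))
               (cong (λ l → C z l (suc (suc R + suc R))) (lem q r″)))))
        where
        av = swap-avoids swapR za zb
        nG : G r′ ≢ z
        nG x = za (trans (sym x) (proj₁ (proj₂ offset₁)))
        lem : ∀ q r → suc q + suc r + 0 ≡ suc q + r + 1
        lem = solve-∀

      -- The argument of `offset₁` one letter further out, with the polarity reversed by the swap at
      -- `r′`.
      offset₂ : Swap (suc R) → F r″ ≡ a × G r″ ≡ b
      offset₂ sw with step nosq palF palG r″ (suc R) e₂ (λ x → a≢b (sym x)) (proj₂ (proj₂ offset₁))
      ... | swap x y _     = x , y
      ... | same x nb na _ = ⊥-elim (K-clash z (suc q + r″) iq₂ 0 0 (suc R) (firstG r″) (lastG r″ (suc R) e₂)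
          (λ w → proj₁ av (trans (sym iq₂-left) w)) (λ w → proj₂ av (trans (sym iq₂-right) w))
          (≤-reflexive (level₂ z (G≢X′ e₂) na′ nb′)))
        where
        z = G r″
        na′ : z ≢ a
        na′ w = na (trans x w)
        nb′ : z ≢ b
        nb′ w = nb (trans x w)
        av = swap-avoids sw na′ nb′

      module _ (λ′ : Fin k) (λX : X ≢ λ′) (λG : G R ≢ λ′) (λF : ∀ d → d < R → F d ≢ λ′) where

        free-< : ∀ n → n < R → s (iq + n) ≢ λ′
        free-< n n<R x = λF _ (d<R⇒ {n} eq) (trans (sym (left n _ eq)) x)
          where
          eq : suc n + (R ∸ suc n) ≡ R
          eq = m+[n∸m]≡n n<R

        free : ∀ n → n < suc (suc (R + R)) → s (iq + n) ≢ λ′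
        free n n< x with <-cmp n R
        ... | tri< n<R _ _  = free-< n n<R x
        ... | tri≈ _ refl _ = λX (trans (sym centre) x)
        ... | tri> _ _ R<n with n <? suc (R + R)
        ...   | yes lt = free-< n′ n′<R (trans (palQ n′ n eq) x)
          where
          n′ = (R + R) ∸ n
          eq : n′ + n ≡ R + R
          eq = m∸n+n≡m (≤-pred lt)
          n′<R : n′ < R
          n′<R = +-cancelʳ-< n n′ R (≤-trans (≤-reflexive (cong suc eq)) (+-monoʳ-< R R<n))
        ...   | no nlt = λG (trans (sym (right n R (≤-antisym (≤-pred n<) (≮⇒≥ nlt)))) x)

        -- The `2 + (R + R)` letters from `iq` on avoid `λ′`. If the next letter `G (suc R)` avoids
        -- it too, the window between the `λ′`'s at `i₁` and `i₁ + suc (suc (R + R))` contradicts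
        -- balance. Otherwise the `λ′`'s at `i₂` and `i₂ + suc (suc R)` do: they span `3 + R`
        -- letters, at most `2 + (R + R)` because `0 < R`.
        close : ∀ i₁ i₂ → s i₁ ≡ λ′ → s (i₁ + suc (suc (R + R))) ≡ λ′ →
                (Swap (suc R) → s i₂ ≡ λ′ × s (i₂ + suc (suc R)) ≡ λ′) → (G (suc R) ≡ λ′ → Swap (suc R)) → ⊥
        close i₁ i₂ p₁ p₂ h sw with G (suc R) ≟ λ′
        ... | yes x = bal-gap bal {i = i₂} {j = iq} (suc R) (proj₁ (h (sw x))) (proj₂ (h (sw x)))
                (λ n n< → free n (≤-trans n< (s≤s (s≤s (≤-trans (≤-reflexive (+-comm 1 R)) (+-monoʳ-≤ R R>0))))))
        ... | no x  = bal-gap bal {i = i₁} {j = iq} (suc (R + R)) p₁ p₂ free′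
          where
          free′ : ∀ n → n < 3 + (R + R) → s (iq + n) ≢ λ′
          free′ n n< y with n <? suc (suc (R + R))
          ... | yes lt = free n lt y
          ... | no nlt = x (trans (sym (right n (suc R) (trans (≤-antisym (≤-pred n<) (≮⇒≥ nlt)) (cong suc (sym (+-suc R R)))))) y)

      R+1 : suc R + r′ ≡ m
      R+1 = trans (+-comm (suc R) r′) e₁

      d≢ : ∀ d → d < R → F d ≢ a × F d ≢ b
      d≢ d d<R with swapped nosq palF palG a≢b (m ∸ d) d (m+[n∸m]≡n (<⇒≤ (≤-trans d<R (≤-trans (m≤m+n R _) (≤-reflexive e)))))
      ... | inj₁ (_ , na , nb)    = na , nb
      ... | inj₂ (inj₁ (x , y)) = ⊥-elim (a≢b (trans (sym x) (trans (agree d d<R) y)))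
      ... | inj₂ (inj₂ (x , y)) = ⊥-elim (a≢b (trans (sym y) (trans (sym (agree d d<R)) x)))

      swap-G : ∀ {z} → z ≡ a ⊎ z ≡ b → G (suc R) ≡ z → Swap (suc R)
      swap-G {z} h x with swapped nosq palF palG a≢b r′ (suc R) R+1
      ... | inj₂ y = y
      ... | inj₁ (y , na , nb) with h
      ...   | inj₁ w = ⊥-elim (na (trans y (trans x w)))
      ...   | inj₂ w = ⊥-elim (nb (trans y (trans x w)))

      conflict : ⊥
      conflict with swapR
      -- Here `G R` is `b`, so `a` is the avoided letter: `G` has it at `r′` and at the mirror image
      -- of `r′`, and `F` has it at its centre and, in the second case of `close`, at `r″`. The
      -- other branch exchanges the roles.
      ... | inj₁ (x , y) = close a (λ w → F≢X m (m≤m+n m m) (sym w)) (λ w → a≢b (trans (sym w) y)) (λ d d<R → proj₁ (d≢ d d<R))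
            (suc q + r′) (suc p + r″) (proj₁ (proj₂ offset₁)) (trans (lastG r′ R e₁) (proj₁ (proj₂ offset₁)))
            (λ sw → proj₁ (offset₂ sw) , at (trans (+-assoc (suc p) r″ _) (cong (suc p +_) e₂)))
            (swap-G (inj₁ refl))
      ... | inj₂ (x , y) = close b (λ w → G≢X m (m≤m+n m m) (sym w)) (λ w → a≢b (trans (sym y) w)) (λ d d<R → proj₂ (d≢ d d<R))
            (suc p + r′) (suc q + r″) (proj₁ offset₁) (trans (lastF r′ R e₁) (proj₁ offset₁))
            (λ sw → proj₂ (offset₂ sw) , at (trans (+-assoc (suc q) r″ _) (cong (suc q +_) e₂)))
            (swap-G (inj₂ refl))

    agree-below : F 0 ≡ G 0 → F m ≢ G m → ∀ n → n ≤ m → ∀ j → j < n → F j ≡ G j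
    agree-below eq a≢b (suc n) n<m j j<sn with m≤n⇒m<n∨m≡n (≤-pred j<sn)
    ... | inj₁ j<n = agree-below eq a≢b n (<⇒≤ n<m) j j<n
    ... | inj₂ refl with F j ≟ G j
    ...   | yes x = x
    ...   | no ne = ⊥-elim (first-difference j (m ∸ suc j) (trans (+-suc j _) (m+[n∸m]≡n n<m)) (agree-below eq a≢b j (<⇒≤ n<m)) ne)
      where
      first-difference : ∀ R r′ → R + suc r′ ≡ m → (∀ j → j < R → F j ≡ G j) → F R ≢ G R → ⊥
      first-difference zero    r′       e agree differ = differ eq
      -- Now `r′` is index `0`, where `offset₁` puts the different letters `b` and `a`.
      first-difference (suc R) zero     e agree differ = a≢b (trans (sym (proj₁ (proj₂ offset₁))) (trans (sym eq) (proj₁ offset₁)))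
        where open FirstDifference e agree differ a≢b
      first-difference (suc R) (suc r″) e agree differ = Conflict.conflict e z<s agree differ a≢b

    agree-all : F 0 ≡ G 0 → ∀ j → j < m → F j ≡ G j
    agree-all eq j j<m with F m ≟ G m
    ... | yes a≡b = proj₁ (equal-centres nosq palF palG a≡b (m ∸ j) j (m+[n∸m]≡n (<⇒≤ j<m)))
    ... | no a≢b  = agree-below eq a≢b m ≤-refl j j<m

    -- For `R = m` the left half of the window about `X` is the first half of `F` reversed, and
    -- `Q≡F` identifies it with the first half of `F` itself, free of the centre letter.
    half-pal : F 0 ≡ G 0 → ∀ j j′ → suc (j + j′) ≡ m → F j ≡ F j′ × F j ≢ F m
    half-pal eq j j′ e =
      trans (sym (left j′ j e′)) (trans (proj₁ Q) (at (cong (_+ j′) (+-identityʳ (suc p))))) ,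
      λ x → proj₂ Q (trans (left j′ j e′) x)
      where
      e′ : suc (j′ + j) ≡ m
      e′ = trans (cong suc (+-comm j′ j)) e
      open Around {m} {0} (+-identityʳ m) (agree-all eq)
      Q = Q≡F j′ j e′

  -- Combs: equally spaced palindromic blocks with the same first letter

  data Anchor (o T : ℕ) : ℕ → Set where
    here  : Anchor o T o
    there : ∀ {p} → Anchor o T p → Anchor o T (p + T)

  split-anchor : ∀ {o m p} → Anchor o (suc m) p →
    Anchor o (suc (suc (m + m))) p ⊎ ∃[ p′ ] (p ≡ suc p′ + m × Anchor o (suc (suc (m + m))) p′)
  split-anchor here = inj₁ here
  split-anchor {m = m} (there {p} A) with split-anchor A
  ... | inj₁ A′              = inj₂ (p , +-suc p m , A′)
  ... | inj₂ (p′ , refl , A′) = inj₁ (subst (Anchor _ _) (lem p′ m) (there A′))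
    where
    lem : ∀ p m → p + suc (suc (m + m)) ≡ suc p + m + suc m
    lem = solve-∀

  record Comb (o N : ℕ) (y : Fin k) : Set where
    field
      block : ∀ {p} → Anchor o (suc N) p → Block N p
      start : ∀ {p} → Anchor o (suc N) p → s (suc p) ≡ y

  open Comb

  -- By `half-pal` every block is `P c P` with `P` a palindrome that avoids `c`, so the centre `c`
  -- can serve as a new delimiter. Both copies of `P` start with `y`; `0 < m` makes `P` non-empty.
  halve : ∀ {o m y} → 0 < m → Comb o (suc (m + m)) y → Comb o m y
  halve {o} {suc m′} {y} _ cb = record { block = blk ; start = st }
    where
    m = suc m′
    T = suc (suc (m + m))
    module Nb {p} (A : Anchor o T p) = Neighbours {m} (block cb A) (block cb (there A))

    eqstart : ∀ {p} (A : Anchor o T p) → Nb.F A 0 ≡ Nb.G A 0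
    eqstart {p} A = trans (at (+-identityʳ (suc p))) (trans (start cb A) (sym (trans (at (+-identityʳ (suc (p + T)))) (start cb (there A)))))

    half : ∀ {p} (A : Anchor o T p) j j′ → suc (j + j′) ≡ m → s (suc p + j) ≡ s (suc p + j′) × s (suc p + j) ≢ s (suc p + m)
    half A = Nb.half-pal A (eqstart A)

    second : ∀ {p} (A : Anchor o T p) j j′ → suc (j + j′) ≡ m → s (suc (suc p + m) + j) ≡ s (suc p + j′)
    second {p} A j j′ e = trans (at (lem p m j)) (Nb.palF A (suc m + j) j′ (trans (lem′ m j j′) (cong (m +_) e)))
      where
      lem : ∀ p m j → suc (suc p + m) + j ≡ suc p + (suc m + j)
      lem = solve-∀
      lem′ : ∀ m j j′ → suc m + j + j′ ≡ m + suc (j + j′)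
      lem′ = solve-∀

    co : ∀ {j} → j < m → suc (j + (m ∸ suc j)) ≡ m
    co j<m = m+[n∸m]≡n j<m

    co′ : ∀ {j} → j < m → suc ((m ∸ suc j) + j) ≡ m
    co′ {j} j<m = trans (cong suc (+-comm (m ∸ suc j) j)) (co j<m)

    co< : ∀ {j} → j < m → m ∸ suc j < suc (m + m)
    co< {j} j<m = s≤s (≤-trans (m∸n≤m m (suc j)) (m≤m+n m m))

    blk : ∀ {p} → Anchor o (suc m) p → Block m p
    blk {p} A with split-anchor A
    ... | inj₁ A′ = record
      { pal = λ n n′ e → proj₁ (half A′ n n′ e)
      ; freshˡ = λ j j<m → Block.freshˡ (block cb A′) j (≤-trans j<m (≤-trans (m≤m+n m m) (n≤1+n _)))
      ; freshʳ = λ j j<m x → proj₂ (half A′ j _ (co j<m)) (trans x (at (+-suc p m)))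
      }
    ... | inj₂ (p′ , refl , A′) = record
      { pal = λ n n′ e → trans (second A′ n n′ e) (trans (proj₁ (half A′ n′ n (trans (cong suc (+-comm n′ n)) e)))
                (sym (second A′ n′ n (trans (cong suc (+-comm n′ n)) e))))
      ; freshˡ = λ j j<m x → proj₂ (half A′ _ j (co′ j<m)) (trans (sym (second A′ j _ (co j<m))) x)
      ; freshʳ = λ j j<m x → Block.freshʳ (block cb A′) _ (co< j<m) (trans (sym (second A′ j _ (co j<m))) (trans x (at (lem p′ m))))
      }
      where
      lem : ∀ p m → suc p + m + suc m ≡ p + suc (suc (m + m))
      lem = solve-∀

    st : ∀ {p} → Anchor o (suc m) p → s (suc p) ≡ y
    st {p} A with split-anchor A
    ... | inj₁ A′ = start cb A′
    ... | inj₂ (p′ , refl , A′) = trans (at (sym (+-identityʳ (suc (suc p′ + m))))) (trans (second A′ 0 m′ refl)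
            (trans (sym (proj₁ (half A′ 0 m′ refl))) (trans (at (+-identityʳ (suc p′))) (start cb A′))))

  anchor₂ : ∀ o n → Anchor o 2 (o + n) ⊎ ∃[ p ] (o + n ≡ suc p × Anchor o 2 p)
  anchor₂ o zero = inj₁ (subst (Anchor o 2) (sym (+-identityʳ o)) here)
  anchor₂ o (suc n) with anchor₂ o n
  ... | inj₁ A = inj₂ (o + n , +-suc o n , A)
  ... | inj₂ (p , e , A) = inj₁ (subst (Anchor o 2) (trans (+-comm p 2) (trans (cong suc (sym e)) (sym (+-suc o n)))) (there A))

  -- A palindrome of positive even length has a square in its middle, so the length stays odd under
  -- halving and ends at `1`, where every second letter is `y`.
  comb-separates : ∀ fuel {o N y} → N ≤ fuel → 0 < N → Comb o N y → ∀ n → s (o + n) ≡ y ⊎ s (suc (o + n)) ≡ y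
  comb-separates zero z≤n ()
  comb-separates (suc f) {o} {N} {y} N≤f 0<N cb with halving N
  ... | even zero = ⊥-elim (n≮0 0<N)
  ... | even (suc h) = ⊥-elim (nosq (suc o + h) (trans (Block.pal (block cb here) h (suc h) refl) (at (+-suc (suc o) h))))
  ... | odd (suc m) = comb-separates f (≤-trans (s≤s (m≤m+n m (suc m))) (≤-pred N≤f)) z<s (halve z<s cb)
  ... | odd zero = go
    where
    go : ∀ n → s (o + n) ≡ y ⊎ s (suc (o + n)) ≡ y
    go n with anchor₂ o n
    ... | inj₁ A           = inj₂ (start cb A)
    ... | inj₂ (p , e , A) = inj₁ (trans (at e) (start cb A))

-- Blocks between consecutive occurrences of a letter

module XBlocks {k} (s : Word k) (bal : Balanced s) (rec : Recurrent s) (x : Fin k) where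
  open Counting s
  open Pairs s bal

  Next : ℕ → ℕ → Set
  Next p N = s (p + suc N) ≡ x × (∀ j → j < N → s (suc p + j) ≢ x)

  PalindromicReturns : Set
  PalindromicReturns = ∀ p N → s p ≡ x → Next p N → ∀ n n′ → suc (n + n′) ≡ N → s (suc p + n) ≡ s (suc p + n′)

  first-from : ∀ p d → s (p + d) ≡ x → ∃[ N ] (s (p + N) ≡ x × (∀ j → j < N → s (p + j) ≢ x))
  first-from p d e with s p ≟ x
  ... | yes h = 0 , trans (cong s (+-identityʳ p)) h , λ _ ()
  first-from p zero e | no h = ⊥-elim (h (trans (cong s (sym (+-identityʳ p))) e))
  first-from p (suc d) e | no h with first-from (suc p) d (trans (cong s (sym (+-suc p d))) e)
  ... | N , hit , miss = suc N , trans (cong s (+-suc p N)) hit , miss′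
    where
    miss′ : ∀ j → j < suc N → s (p + j) ≢ x
    miss′ zero    _ y = h (trans (cong s (sym (+-identityʳ p))) y)
    miss′ (suc j) (s≤s lt) y = miss j lt (trans (cong s (sym (+-suc p j))) y)

  next : ∀ p → s p ≡ x → ∃[ N ] Next p N
  next p e with rec (x ∷ []) (p , cong (_∷ []) e) (suc p)
  ... | i , p<i , eq with first-from (suc p) (i ∸ suc p) (trans (cong s (m+[n∸m]≡n p<i)) (∷-injectiveˡ eq))
  ... | N , hit , miss = N , trans (cong s (+-suc p N)) hit , miss

  module _ (xpal : PalindromicReturns) (nosq : NoSquare) where
    open Descent s bal nosq

    gap-odd : ∀ {p N} → s p ≡ x → Next p N → ∃[ m ] N ≡ suc (m + m)
    gap-odd {p} {N} e nx with halving N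
    ... | odd m = m , refl
    ... | even zero = ⊥-elim (nosq p (trans e (trans (sym (proj₁ nx)) (cong s (+-comm p 1)))))
    ... | even (suc h) = ⊥-elim (nosq (suc p + h) (trans (xpal p _ e nx h (suc h) refl) (cong s (+-suc (suc p) h))))

    -- Both lengths are odd, so the longer block exceeds the shorter by at least two letters: it is
    -- an `x`-free window as long as the shorter block together with its two `x`'s.
    gap-< : ∀ {p p′ m m′} → s p ≡ x → Next p (suc (m + m)) → Next p′ (suc (m′ + m′)) → m < m′ → ⊥
    gap-< {p} {p′} {m} {m′} e (hit , _) (_ , miss) m<m′ =
      bal-gap bal {i = p} {j = suc p′} (suc (m + m)) e hit
        (λ n n< → miss n (≤-trans n< (s≤s (≤-trans (≤-reflexive (cong suc (sym (+-suc m m)))) (+-mono-≤ m<m′ m<m′)))))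

    gap-≡ : ∀ {p p′ N N′} → s p ≡ x → Next p N → s p′ ≡ x → Next p′ N′ → N ≡ N′
    gap-≡ e nx e′ nx′ with gap-odd e nx | gap-odd e′ nx′
    ... | m , refl | m′ , refl with <-cmp m m′
    ...   | tri< lt _ _   = ⊥-elim (gap-< e nx nx′ lt)
    ...   | tri≈ _ refl _ = refl
    ...   | tri> _ _ gt   = ⊥-elim (gap-< e′ nx′ nx gt)

    module Anchored {o N} (so : s o ≡ x) (nx : Next o N) where

      anchor : ∀ {p} → Anchor o (suc N) p → s p ≡ x × Next p N
      anchor here = so , nx
      anchor (there {p} A) with anchor A
      ... | e , hit , _ with next (p + suc N) hit
      ...   | N′ , nx′ = hit , subst (Next (p + suc N)) (sym (gap-≡ so nx hit nx′)) nx′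

      blocks : ∀ {p} → Anchor o (suc N) p → Block N p
      blocks {p} A = record
        { pal    = xpal p N (proj₁ (anchor A)) (proj₂ (anchor A))
        ; freshˡ = λ j j< y → proj₂ (proj₂ (anchor A)) j j< (trans y (proj₁ (anchor A)))
        ; freshʳ = λ j j< y → proj₂ (proj₂ (anchor A)) j j< (trans y (proj₁ (proj₂ (anchor A))))
        }

      blocks≢x : ∀ {p} → Anchor o (suc N) p → ∀ j → j < N → s (suc p + j) ≢ x
      blocks≢x A = proj₂ (proj₂ (anchor A))

    x-separates : ∀ {o} → s o ≡ x → Next o 1 → ∀ n → s (o + n) ≡ x ⊎ s (suc (o + n)) ≡ x
    x-separates {o} so nx n with anchor₂ o n
    ... | inj₁ A = inj₁ (proj₁ (Anchored.anchor so nx A))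
    ... | inj₂ (p , e , A) = inj₂ (trans (cong s (trans (cong suc e) (+-comm 2 p))) (proj₁ (Anchored.anchor so nx (there A))))

    -- Blocks of length at least three

    module LongGaps {o m′} (so : s o ≡ x) (nx : Next o (suc (suc m′ + suc m′))) where
      m N T : ℕ
      m = suc m′
      N = suc (m + m)
      T = suc N

      open Anchored so nx public

      first : ∀ p → s (suc p + 0) ≡ s (suc p)
      first p = cong s (+-identityʳ (suc p))

      palB : ∀ {p} → Anchor o T p → Pal (suc p) m
      palB A n n′ e = Block.pal (blocks A) n n′ (cong suc e)

      around-centre : ∀ {p} (A : Anchor o T p) → s (1 + (suc p + m′)) ≡ s (suc p + m) × s (2 + (suc p + m′)) ≡ s (suc p + m′)
      around-centre {p} A = cong s (sym (+-suc (suc p) m′)) ,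
        trans (cong s (lem p m′)) (palB A (suc m) m′ (lem′ m′))
        where
        lem : ∀ p m → 2 + (suc p + m) ≡ suc p + suc (suc m)
        lem = solve-∀
        lem′ : ∀ m → suc (suc m) + m ≡ suc m + suc m
        lem′ = solve-∀

      lastOf : ℕ → ℕ
      lastOf p = suc p + (m + m)

      last-letter : ∀ {p} (A : Anchor o T p) → s (lastOf p) ≡ s (suc p)
      last-letter {p} A = trans (palB A (m + m) 0 (+-identityʳ (m + m))) (first p)

      after-last : ∀ {p} (A : Anchor o T p) → s (1 + lastOf p) ≡ x
      after-last {p} A = trans (cong s (lem p m)) (proj₁ (anchor (there A)))
        where
        lem : ∀ p m → 1 + (suc p + (m + m)) ≡ p + suc (suc (m + m))
        lem = solve-∀

      next-start : ∀ p → s (2 + lastOf p) ≡ s (suc (p + T))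
      next-start p = cong s (lem p m)
        where
        lem : ∀ p m → 2 + (suc p + (m + m)) ≡ suc (p + suc (suc (m + m)))
        lem = solve-∀

      start≢x : ∀ {p} → Anchor o T p → s (suc p) ≢ x
      start≢x {p} A y = blocks≢x A 0 z<s (trans (first p) y)

      module DifferentStarts {p p′} (A : Anchor o T p) (A′ : Anchor o T p′) (ne : s (suc p) ≢ s (suc p′)) where
        a b : Fin k
        a = s (suc p + m)
        b = s (suc p′ + m)

        a≢b : a ≢ b
        a≢b e = ne (trans (sym (first p)) (trans (proj₁ (equal-centres nosq (palB A) (palB A′) e m 0 refl)) (first p′)))

        starts : (s (suc p) ≡ a × s (suc p′) ≡ b) ⊎ (s (suc p) ≡ b × s (suc p′) ≡ a)
        starts with swapped nosq (palB A) (palB A′) a≢b m 0 refl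
        ... | inj₁ (e , _) = ⊥-elim (ne (trans (sym (first p)) (trans e (first p′))))
        ... | inj₂ (inj₁ (e , e′)) = inj₁ (trans (sym (first p)) e , trans (sym (first p′)) e′)
        ... | inj₂ (inj₂ (e , e′)) = inj₂ (trans (sym (first p)) e , trans (sym (first p′)) e′)

        -- The three middle letters of the two blocks are thus `c a c` and `c b c` with a third
        -- letter `c`, or `b a b` and `a b a`.
        centre-3 : (s (suc p + m′) ≡ s (suc p′ + m′) × s (suc p + m′) ≢ a × s (suc p + m′) ≢ b)
                   ⊎ (s (suc p + m′) ≡ b × s (suc p′ + m′) ≡ a)
        centre-3 = next-to-centre nosq (palB A) (palB A′) a≢b m′ refl

      Triple : Fin k → Fin k → Fin k → Set
      Triple c d e = ∃[ i ] (s i ≡ c × s (1 + i) ≡ d × s (2 + i) ≡ e)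

      triple-at : ∀ {p c d} (A : Anchor o T p) → s (suc p + m′) ≡ c → s (suc p + m) ≡ d → Triple c d c
      triple-at {p} A e₁ e₂ = suc p + m′ , e₁ , trans (proj₁ (around-centre A)) e₂ , trans (proj₂ (around-centre A)) e₁

      triple-clash : ∀ {z c d e f} → Triple z c z → Triple d e f → (z ≢ d) → (z ≢ e) → (z ≢ f) → ⊥
      triple-clash (i , p , _ , q) (j , p′ , q′ , r′) n₁ n₂ n₃ =
        bal-gap3 bal i j p q (λ w → n₁ (trans (sym w) p′)) (λ w → n₂ (trans (sym w) q′)) (λ w → n₃ (trans (sym w) r′))

      anchor-triple : ∀ {p} (A : Anchor o T p) → Triple (s (suc p)) x (s (suc (p + T)))
      anchor-triple {p} A = lastOf p , last-letter A , after-last A , next-start p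

      -- The hypothesis makes `y x y` a factor. A block starting with `t ≢ y` would make `y` and `t`
      -- the two centres. Then either the three letters about the centre `t` avoid `y`, or `t y t`
      -- is a factor while `y x y` avoids `t`.
      all-start : s (suc o) ≡ s (suc (o + T)) → ∀ {p} → Anchor o T p → s (suc p) ≡ s (suc o)
      all-start eq {p} A with s (suc o) ≟ s (suc p)
      ... | yes e = sym e
      ... | no ne = ⊥-elim (contra starts centre-3)
        where
        open DifferentStarts here A ne
        y t : Fin k
        y = s (suc o)
        t = s (suc p)
        yxy : Triple y x y
        yxy = subst (Triple y x) (sym eq) (anchor-triple here)
        tx : t ≢ x
        tx = start≢x A
        contra : _ → _ → ⊥
        contra (inj₁ (ya , tb)) (inj₁ (e , na , nb)) =
          triple-clash yxy (triple-at A refl refl) (λ w → na (trans e (trans (sym w) ya))) (λ w → ne (trans w (sym tb))) (λ w → na (trans e (trans (sym w) ya)))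
        contra (inj₂ (yb , ta)) (inj₁ (e , na , nb)) =
          triple-clash yxy (triple-at here refl refl) (λ w → nb (trans (sym w) yb)) (λ w → ne (trans w (sym ta))) (λ w → nb (trans (sym w) yb))
        contra (inj₁ (ya , tb)) (inj₂ (e , e′)) =
          triple-clash (triple-at here (trans e (sym tb)) refl) yxy (λ w → ne (sym w)) tx (λ w → ne (sym w))
        contra (inj₂ (yb , ta)) (inj₂ (e , e′)) =
          triple-clash (triple-at A (trans e′ (sym ta)) refl) yxy (λ w → ne (sym w)) tx (λ w → ne (sym w))

      y-separates : s (suc o) ≡ s (suc (o + T)) → ∀ n → s (o + n) ≡ s (suc o) ⊎ s (suc (o + n)) ≡ s (suc o)
      y-separates eq = comb-separates N ≤-refl z<s (record { block = blocks ; start = all-start eq })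

      module Alternating (ne : s (suc o) ≢ s (suc (o + T))) where
        open DifferentStarts here (there here) ne

        u t : Fin k
        u = s (suc o)
        t = s (suc (o + T))

        u≢x : u ≢ x
        u≢x = start≢x here

        t≢x : t ≢ x
        t≢x = start≢x (there here)

        uxt : Triple u x t
        uxt = anchor-triple here

        -- If a third letter `c` surrounded the centres, a factor with `c` at both ends would clash
        -- with `u x t`, which avoids `c` because blocks contain no `x`.
        utu×tut : Triple u t u × Triple t u t
        utu×tut = go starts centre-3
          where
          go : _ → _ → Triple u t u × Triple t u t
          go st (inj₁ (e , na , nb)) = ⊥-elim (triple-clash (triple-at here refl refl) uxt
            (away st) (blocks≢x here m′ (s≤s (≤-trans (n≤1+n m′) (m≤m+n m m)))) (away′ st))
            where
            away : _ → s (suc o + m′) ≢ u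
            away (inj₁ (ua , _)) w = na (trans w ua)
            away (inj₂ (ub , _)) w = nb (trans w ub)
            away′ : _ → s (suc o + m′) ≢ t
            away′ (inj₁ (_ , tb)) w = nb (trans w tb)
            away′ (inj₂ (_ , ta)) w = na (trans w ta)
          go (inj₁ (ua , tb)) (inj₂ (e , e′)) =
            triple-at (there here) (trans e′ (sym ua)) (sym tb) , triple-at here (trans e (sym tb)) (sym ua)
          go (inj₂ (ub , ta)) (inj₂ (e , e′)) =
            triple-at here (trans e (sym ub)) (sym ta) , triple-at (there here) (trans e′ (sym ta)) (sym ub)

        has-u : ∀ {c d e} → Triple c d e → u ≢ c → u ≢ d → u ≡ e
        has-u {e = e} tr n₁ n₂ with u ≟ e
        ... | yes w = w
        ... | no n₃ = ⊥-elim (triple-clash (proj₁ utu×tut) tr n₁ n₂ n₃)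

        has-t : ∀ {c d e} → Triple c d e → t ≢ d → t ≢ e → t ≡ c
        has-t {c} tr n₂ n₃ with t ≟ c
        ... | yes w = w
        ... | no n₁ = ⊥-elim (triple-clash (proj₂ utu×tut) tr n₁ n₂ n₃)

        uxtu : ∃[ i ] (s i ≡ u × s (1 + i) ≡ x × s (2 + i) ≡ t × s (3 + i) ≡ u)
        uxtu = lastOf o , last-letter here , after-last here , next-start o ,
          sym (has-u (1 + lastOf o , after-last here , next-start o , refl) u≢x ne)

        tuxt : ∃[ i ] (s i ≡ t × s (1 + i) ≡ u × s (2 + i) ≡ x × s (3 + i) ≡ t)
        tuxt = o + (m + m) , sym (has-t (o + (m + m) , refl , last-letter here , after-last here) (λ w → ne (sym w)) t≢x) ,
          last-letter here , after-last here , next-start o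

        Swapped : Fin k → Fin k → Set
        Swapped = Exchanged u t

        -- Balance against `u t u` and `t u t` puts both `u` and `t` into any three consecutive
        -- letters; around an `x` they must be its two neighbours.
        neighbours : ∀ {p} → Anchor o T p → (s (suc p) ≡ u × s (suc (p + T)) ≡ t) ⊎ (s (suc p) ≡ t × s (suc (p + T)) ≡ u)
        neighbours {p} A with u ≟ s (suc p)
        ... | no n₁ = inj₂ (sym (has-t (anchor-triple A) t≢x (λ w → ne (trans u≡ (sym w)))) , sym u≡)
          where
          u≡ : u ≡ s (suc (p + T))
          u≡ = has-u (anchor-triple A) n₁ u≢x
        ... | yes e with t ≟ s (suc (p + T))
        ...   | yes e′ = inj₁ (sym e , sym e′)
        ...   | no n₃  = ⊥-elim (ne (trans e (sym (has-t (anchor-triple A) t≢x n₃))))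

        -- The transposition given by `swapped` is that of the centres; `starts` and `neighbours`
        -- identify it with that of `u` and `t`, in one order or the other.
        swapped-half : ∀ {p} → Anchor o T p → ∀ j → j ≤ m → Swapped (s (suc p + j)) (s (suc (p + T) + j))
        swapped-half {p} A j j≤m = go (D.starts) (swapped nosq (palB A) (palB (there A)) D.a≢b (m ∸ j) j (m+[n∸m]≡n j≤m))
          where
          ne′ : s (suc p) ≢ s (suc (p + T))
          ne′ e with neighbours A
          ... | inj₁ (w , w′) = ne (trans (sym w) (trans e w′))
          ... | inj₂ (w , w′) = ne (trans (sym w′) (trans (sym e) w))
          module D = DifferentStarts A (there A) ne′
          rename : ∀ {α α′ β β′ c d} → α ≡ α′ → β ≡ β′ → Exchanged α β c d → Exchanged α′ β′ c d
          rename refl refl h = h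
          go : _ → Exchanged D.a D.b (s (suc p + j)) (s (suc (p + T) + j)) → Swapped (s (suc p + j)) (s (suc (p + T) + j))
          go st sw with neighbours A | st
          ... | inj₁ (w , w′) | inj₁ (v , v′) = rename (trans (sym v) w) (trans (sym v′) w′) sw
          ... | inj₁ (w , w′) | inj₂ (v , v′) = exchanged-comm (rename (trans (sym v′) w′) (trans (sym v) w) sw)
          ... | inj₂ (w , w′) | inj₁ (v , v′) = exchanged-comm (rename (trans (sym v) w) (trans (sym v′) w′) sw)
          ... | inj₂ (w , w′) | inj₂ (v , v′) = rename (trans (sym v′) w′) (trans (sym v) w) sw

        swapped-block : ∀ {p} → Anchor o T p → ∀ j → j ≤ m + m → Swapped (s (suc p + j)) (s (suc (p + T) + j))
        swapped-block {p} A j j≤ with j ≤? m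
        ... | yes j≤m = swapped-half A j j≤m
        ... | no j≰m  = subst₂ Swapped (palB A j′ j eq) (palB (there A) j′ j eq) (swapped-half A j′ j′≤m)
          where
          j′ = (m + m) ∸ j
          eq : j′ + j ≡ m + m
          eq = m∸n+n≡m j≤
          j′≤m : j′ ≤ m
          j′≤m = +-cancelʳ-≤ m j′ m (≤-trans (+-monoʳ-≤ j′ (<⇒≤ (≰⇒> j≰m))) (≤-reflexive eq))

        swapped-shift : ∀ n → Swapped (s (o + n)) (s (o + n + T))
        swapped-shift n with locate n
          where
          locate : ∀ n → ∃[ p ] (Anchor o T p × ∃[ j ] (j ≤ N × p + j ≡ o + n))
          locate zero = o , here , 0 , z≤n , refl
          locate (suc n) with locate n
          ... | p , A , j , j≤N , e with m≤n⇒m<n∨m≡n j≤N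
          ...   | inj₁ j<N  = p , A , suc j , j<N , trans (+-suc p j) (trans (cong suc e) (sym (+-suc o n)))
          ...   | inj₂ refl = p + T , there A , 0 , z≤n , trans (+-identityʳ (p + T)) (trans (+-suc p N) (trans (cong suc e) (sym (+-suc o n))))
        ... | p , A , zero , _ , e = subst (λ l → Swapped (s l) (s (l + T))) (trans (sym (+-identityʳ p)) e)
              (inj₁ (trans h (sym h′) , (λ w → u≢x (trans (sym w) h)) , (λ w → t≢x (trans (sym w) h))))
          where
          h = proj₁ (anchor A)
          h′ = proj₁ (anchor (there A))
        ... | p , A , suc j , s≤s j≤ , e =
              subst (λ l → Swapped (s l) (s (l + T))) e (subst₂ (λ c d → Swapped (s c) (s d)) (sym (+-suc p j)) (lem p T j) (swapped-block A j j≤))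
          where
          lem : ∀ p T j → suc (p + T) + j ≡ p + suc j + T
          lem = solve-∀

  -- The trace of the alternating case that the descent works with: short factors of a word whose
  -- images under `ψ` cannot lie in one balanced word.
  record Alternation (u t : Fin k) : Set where
    field
      u≢t  : u ≢ t
      u≢x  : u ≢ x
      t≢x  : t ≢ x
      uxtu : ∃[ i ] (s i ≡ u × s (1 + i) ≡ x × s (2 + i) ≡ t × s (3 + i) ≡ u)
      tuxt : ∃[ i ] (s i ≡ t × s (1 + i) ≡ u × s (2 + i) ≡ x × s (3 + i) ≡ t)
      utu  : ∃[ i ] (s i ≡ u × s (1 + i) ≡ t × s (2 + i) ≡ u)
      tut  : ∃[ i ] (s i ≡ t × s (1 + i) ≡ u × s (2 + i) ≡ t)

  alternation : PalindromicReturns → NoSquare → ∀ o m′ → s o ≡ x → Next o (suc (suc m′ + suc m′)) →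
    s (suc o) ≢ s (suc (o + suc (suc (suc m′ + suc m′)))) → ∃[ u ] ∃[ t ] Alternation u t
  alternation xpal nosq o m′ so nx ne = A.u , A.t , record
    { u≢t = ne ; u≢x = A.u≢x ; t≢x = A.t≢x ; uxtu = A.uxtu ; tuxt = A.tuxt
    ; utu = proj₁ A.utu×tut ; tut = proj₂ A.utu×tut }
    where module A = LongGaps.Alternating xpal nosq {o} {m′} so nx ne

  tail-separating : ∀ {o y} → (∀ n → s (o + n) ≡ y ⊎ s (suc (o + n)) ≡ y) → Separating y
  tail-separating {o} h i with rec (s i ∷ s (suc i) ∷ []) (i , refl) o
  ... | j , o≤j , eq with h (j ∸ o)
  ...   | inj₁ e = inj₁ (trans (sym (∷-injectiveˡ eq)) (trans (cong s (sym (m+[n∸m]≡n o≤j))) e))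
  ...   | inj₂ e = inj₂ (trans (sym (∷-injectiveˡ (∷-injectiveʳ eq))) (trans (cong s (cong suc (sym (m+[n∸m]≡n o≤j)))) e))

  -- A square has a separating letter, so refuting all separating letters supplies `NoSquare`. The
  -- double negation avoids having to search for a square.
  some-separating : PalindromicReturns → ∀ {o N} → s o ≡ x → Next o N →
    (NoSquare → ∀ m′ → N ≡ suc (suc m′ + suc m′) → s (suc o) ≢ s (suc (o + suc N)) → ⊥) →
    (∀ y → ¬ Separating y) → ⊥
  some-separating xpal {o} {N} so nx alternating nosep with gap-odd xpal nosq so nx
    where
    nosq : NoSquare
    nosq i e = nosep (s i) (square⇒separating bal i e)
  ... | zero , refl = nosep x (tail-separating (x-separates xpal nosq so nx))
    where
    nosq : NoSquare
    nosq i e = nosep (s i) (square⇒separating bal i e)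
  ... | suc m′ , refl with s (suc o) ≟ s (suc (o + suc N))
  ...   | yes eq = nosep _ (tail-separating (LongGaps.y-separates xpal (λ i e → nosep (s i) (square⇒separating bal i e)) so nx eq))
  ...   | no ne  = alternating (λ i e → nosep (s i) (square⇒separating bal i e)) m′ refl ne

-- Frequencies

diff-≤ : ∀ {x y d} → x ≤ y + d → y ≤ x + d → ∣ x - y ∣ ≤ d
diff-≤ {x} {y} {d} p q with ≤-total x y
... | inj₁ x≤y = ≤-trans (≤-reflexive (m≤n⇒∣m-n∣≡n∸m x≤y)) (m≤n+o⇒m∸n≤o y x q)
... | inj₂ y≤x = ≤-trans (≤-reflexive (m≤n⇒∣n-m∣≡n∸m y≤x)) (m≤n+o⇒m∸n≤o x y p)

module Frequencies {k} (s : Word k) (bal : Balanced s) where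
  open Counting s

  -- Cut into `n` windows of length `m`, each of which exceeds the window at `j` by at most one.
  C-*-≤ : ∀ z m n i j → C z i (n * m) ≤ n * C z j m + n
  C-*-≤ z m zero    i j = ≤-reflexive (C-zero z i)
  C-*-≤ z m (suc n) i j = begin
    C z i (m + n * m)                       ≡⟨ C-+ z i m (n * m) ⟩
    C z i m + C z (i + m) (n * m)           ≤⟨ +-mono-≤ (C-bal bal z i j m) (C-*-≤ z m n (i + m) j) ⟩
    suc (C z j m) + (n * C z j m + n)       ≡⟨ lem (C z j m) n ⟩
    suc n * C z j m + suc n                 ∎
    where
    open ≤-Reasoning
    lem : ∀ c n → suc c + (n * c + n) ≡ suc n * c + suc n
    lem = solve-∀

  C-*-≥ : ∀ z m n i j → n * C z j m ≤ C z i (n * m) + n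
  C-*-≥ z m zero    i j = z≤n
  C-*-≥ z m (suc n) i j = begin
    C z j m + n * C z j m                         ≤⟨ +-mono-≤ (C-bal bal z j i m) (C-*-≥ z m n (i + m) j) ⟩
    suc (C z i m) + (C z (i + m) (n * m) + n)     ≡⟨ lem (C z i m) (C z (i + m) (n * m)) n ⟩
    C z i m + C z (i + m) (n * m) + suc n         ≡⟨ cong (_+ suc n) (sym (C-+ z i m (n * m))) ⟩
    C z i (suc n * m) + suc n                     ∎
    where
    open ≤-Reasoning
    lem : ∀ c d n → suc c + (d + n) ≡ c + d + suc n
    lem = solve-∀

  -- The prefix of length `m * n` mediates: it is cut into `n` windows of length `m` and also into
  -- `m` windows of length `n`.
  cross-≤ : ∀ z m n → C z 0 m * n ≤ C z 0 n * m + (m + n)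
  cross-≤ z m n = begin
    C z 0 m * n                 ≡⟨ *-comm (C z 0 m) n ⟩
    n * C z 0 m                 ≤⟨ C-*-≥ z m n 0 0 ⟩
    C z 0 (n * m) + n           ≡⟨ cong (λ l → C z 0 l + n) (*-comm n m) ⟩
    C z 0 (m * n) + n           ≤⟨ +-monoˡ-≤ n (C-*-≤ z n m 0 0) ⟩
    m * C z 0 n + m + n         ≡⟨ lem (C z 0 n) m n ⟩
    C z 0 n * m + (m + n)       ∎
    where
    open ≤-Reasoning
    lem : ∀ c m n → m * c + m + n ≡ c * m + (m + n)
    lem = solve-∀

  frequency-exists : ∀ z → FrequencyExists s z
  -- For `m` and `n` at least `2 * suc e`, each of `suc e * m` and `suc e * n` is at most half of
  -- `m * n`.
  frequency-exists z e = 2 * suc e , λ m n N<m N<n → begin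
      suc e * ∣ pref s z m * n - pref s z n * m ∣
        ≡⟨ cong₂ (λ c d → suc e * ∣ c * n - d * m ∣) (sym (C-occ z 0 m)) (sym (C-occ z 0 n)) ⟩
      suc e * ∣ C z 0 m * n - C z 0 n * m ∣
        ≤⟨ *-monoʳ-≤ (suc e) (diff-≤ (cross-≤ z m n) (≤-trans (cross-≤ z n m) (≤-reflexive (cong (C z 0 m * n +_) (+-comm n m))))) ⟩
      suc e * (m + n)  ≤⟨ *-cancelˡ-≤ 2 (bound m n (<⇒≤ N<m) (<⇒≤ N<n)) ⟩
      m * n            ∎
    where
    open ≤-Reasoning
    lem : ∀ e m n → 2 * (e * (m + n)) ≡ 2 * e * m + 2 * e * n
    lem = solve-∀
    lem′ : ∀ m n → n * m + m * n ≡ 2 * (m * n)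
    lem′ = solve-∀
    bound : ∀ m n → 2 * suc e ≤ m → 2 * suc e ≤ n → 2 * (suc e * (m + n)) ≤ 2 * (m * n)
    bound m n p q = ≤-trans (≤-reflexive (lem (suc e) m n)) (≤-trans (+-mono-≤ (*-monoˡ-≤ m q) (*-monoˡ-≤ n p)) (≤-reflexive (lem′ m n)))

  module _ {u t : Fin k} (u≢t : u ≢ t) {o T : ℕ} (T>0 : 0 < T)
           (shift : ∀ n → Exchanged u t (s (o + n)) (s (o + n + T))) where

    ind-exchanged : ∀ {c d} → Exchanged u t c d → ind u d ≡ ind t c × ind t d ≡ ind u c
    ind-exchanged (inj₁ (refl , nu , nt)) = trans (ind-miss nu) (sym (ind-miss nt)) , trans (ind-miss nt) (sym (ind-miss nu))
    ind-exchanged (inj₂ (inj₁ (refl , refl))) =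
      trans (ind-miss (λ e → u≢t (sym e))) (sym (ind-miss u≢t)) , trans (ind-hit refl) (sym (ind-hit refl))
    ind-exchanged (inj₂ (inj₂ (refl , refl))) =
      trans (ind-hit refl) (sym (ind-hit refl)) , trans (ind-miss u≢t) (sym (ind-miss (λ e → u≢t (sym e))))

    C-shift : ∀ L n → C u (o + n + T) L ≡ C t (o + n) L × C t (o + n + T) L ≡ C u (o + n) L
    C-shift zero n = trans (C-zero u _) (sym (C-zero t _)) , trans (C-zero t _) (sym (C-zero u _))
    C-shift (suc L) n with C-shift L (suc n) | ind-exchanged (shift n)
    ... | p , q | p′ , q′ =
      trans (C-suc u _ L) (trans (cong₂ _+_ p′ (subst (λ l → C u (l + T) L ≡ C t l L) (+-suc o n) p)) (sym (C-suc t _ L))) ,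
      trans (C-suc t _ L) (trans (cong₂ _+_ q′ (subst (λ l → C t (l + T) L ≡ C u l L) (+-suc o n) q)) (sym (C-suc u _ L)))

    -- The `u`'s of `T` letters become the `t`'s of the next `T` and conversely, so both totals are
    -- the same sum in opposite order.
    period : ∀ n → C u (o + n) (T + T) ≡ C t (o + n) (T + T)
    period n = begin
      C u (o + n) (T + T)                  ≡⟨ C-+ u (o + n) T T ⟩
      C u (o + n) T + C u (o + n + T) T    ≡⟨ cong₂ _+_ (sym (proj₂ (C-shift T n))) (proj₁ (C-shift T n)) ⟩
      C t (o + n + T) T + C t (o + n) T    ≡⟨ +-comm _ (C t (o + n) T) ⟩
      C t (o + n) T + C t (o + n + T) T    ≡⟨ C-+ t (o + n) T T ⟨
      C t (o + n) (T + T)                  ∎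
      where open ≡-Reasoning

    -- Full stretches of `T + T` letters contribute equally by `period`; the remainder has at most
    -- `T + T` letters.
    close : ∀ fuel L n → L ≤ fuel → C u (o + n) L ≤ C t (o + n) L + (T + T) × C t (o + n) L ≤ C u (o + n) L + (T + T)
    close fuel L n le with L ≤? T + T
    ... | yes L≤ = ≤-trans (C-≤ u _ L) (≤-trans L≤ (m≤n+m _ (C t (o + n) L))) , ≤-trans (C-≤ t _ L) (≤-trans L≤ (m≤n+m _ (C u (o + n) L)))
    close zero    .zero n z≤n | no L≰ = ⊥-elim (L≰ z≤n)
    close (suc f) L n le | no L≰ with close f (L ∸ (T + T)) (n + (T + T)) (≤-trans (∸-monoʳ-≤ L (≤-trans T>0 (m≤m+n T T))) (∸-monoˡ-≤ 1 le))
    ... | p , q = subst (λ l → C u (o + n) l ≤ C t (o + n) l + (T + T) × C t (o + n) l ≤ C u (o + n) l + (T + T)) (m+[n∸m]≡n (<⇒≤ (≰⇒> L≰)))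
        (half u t (period n) p , half t u (sym (period n)) q)
      where
      L′ = L ∸ (T + T)
      half : ∀ c d → C c (o + n) (T + T) ≡ C d (o + n) (T + T) → C c (o + (n + (T + T))) L′ ≤ C d (o + (n + (T + T))) L′ + (T + T) →
             C c (o + n) (T + T + L′) ≤ C d (o + n) (T + T + L′) + (T + T)
      half c d eq h = begin
        C c (o + n) (T + T + L′)                                 ≡⟨ C-+ c (o + n) (T + T) L′ ⟩
        C c (o + n) (T + T) + C c (o + n + (T + T)) L′           ≡⟨ cong₂ (λ a l → a + C c l L′) eq (+-assoc o n (T + T)) ⟩
        C d (o + n) (T + T) + C c (o + (n + (T + T))) L′         ≤⟨ +-monoʳ-≤ _ h ⟩
        C d (o + n) (T + T) + (C d (o + (n + (T + T))) L′ + (T + T)) ≡⟨ +-assoc (C d (o + n) (T + T)) _ (T + T) ⟨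
        C d (o + n) (T + T) + C d (o + (n + (T + T))) L′ + (T + T) ≡⟨ cong (λ l → C d (o + n) (T + T) + C d l L′ + (T + T)) (+-assoc o n (T + T)) ⟨
        C d (o + n) (T + T) + C d (o + n + (T + T)) L′ + (T + T) ≡⟨ cong (_+ (T + T)) (C-+ d (o + n) (T + T) L′) ⟨
        C d (o + n) (T + T + L′) + (T + T)                       ∎
        where open ≤-Reasoning

    same-frequency : SameFrequency s u t
    -- The difference never exceeds `o + (T + T)`, where `o` accounts for the letters before `o`.
    same-frequency = frequency-exists u , frequency-exists t , λ e → suc e * (o + (T + T)) , λ n N≤n → begin
        suc e * ∣ pref s u n - pref s t n ∣   ≡⟨ cong₂ (λ c d → suc e * ∣ c - d ∣) (sym (C-occ u 0 n)) (sym (C-occ t 0 n)) ⟩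
        suc e * ∣ C u 0 n - C t 0 n ∣         ≤⟨ *-monoʳ-≤ (suc e) (bound n (≤-trans (≤-trans (m≤m+n o (T + T)) (m≤m+n (o + (T + T)) _)) N≤n)) ⟩
        suc e * (o + (T + T))                 ≤⟨ N≤n ⟩
        n                                     ∎
      where
      open ≤-Reasoning
      lem : ∀ o a b c → o + (a + b) ≤ (c + a) + (o + b)
      lem o a b c = ≤-trans (m≤n+m (o + (a + b)) c) (≤-reflexive (lem′ o a b c))
        where
        lem′ : ∀ o a b c → c + (o + (a + b)) ≡ (c + a) + (o + b)
        lem′ = solve-∀
      side : ∀ c d n → o ≤ n → C c o (n ∸ o) ≤ C d o (n ∸ o) + (T + T) → C c 0 n ≤ C d 0 n + (o + (T + T))
      side c d n o≤n h = subst (λ l → C c 0 l ≤ C d 0 l + (o + (T + T))) (m+[n∸m]≡n o≤n) (begin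
        C c 0 (o + (n ∸ o))                       ≡⟨ C-+ c 0 o (n ∸ o) ⟩
        C c 0 o + C c o (n ∸ o)                   ≤⟨ +-mono-≤ (C-≤ c 0 o) h ⟩
        o + (C d o (n ∸ o) + (T + T))             ≤⟨ lem o (C d o (n ∸ o)) (T + T) (C d 0 o) ⟩
        C d 0 o + C d o (n ∸ o) + (o + (T + T))   ≡⟨ cong (_+ (o + (T + T))) (C-+ d 0 o (n ∸ o)) ⟨
        C d 0 (o + (n ∸ o)) + (o + (T + T))       ∎)
      bound : ∀ n → o ≤ n → ∣ C u 0 n - C t 0 n ∣ ≤ o + (T + T)
      bound n o≤n = diff-≤ (side u t n o≤n (proj₁ h)) (side t u n o≤n (proj₂ h))
        where
        h = subst (λ l → C u l (n ∸ o) ≤ C t l (n ∸ o) + (T + T) × C t l (n ∸ o) ≤ C u l (n ∸ o) + (T + T)) (+-identityʳ o)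
              (close (n ∸ o) (n ∸ o) 0 ≤-refl)

-- Closure under reversal and oddities

_≟ₗ_ : ∀ {k} (v w : List (Fin k)) → Dec (v ≡ w)
_≟ₗ_ = ≡-dec _≟_

least : ∀ {P : ℕ → Set} → (∀ n → Dec (P n)) → ∀ n → P n → ∃[ m ] (m ≤ n × P m × (∀ l → l < m → ¬ P l))
least P? n p with P? 0
... | yes p₀ = 0 , z≤n , p₀ , λ _ ()
least P? zero    p | no ¬p₀ = ⊥-elim (¬p₀ p)
least P? (suc n) p | no ¬p₀ with least (λ m → P? (suc m)) n p
... | m , m≤n , pm , below = suc m , s≤s m≤n , pm , λ { zero _ → ¬p₀ ; (suc l) (s≤s l<m) → below l l<m }

module Factors {k} (s : Word k) where

  length-sub : ∀ i n → length (sub s i n) ≡ n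
  length-sub i zero    = refl
  length-sub i (suc n) = cong suc (length-sub (suc i) n)

  sub-+ : ∀ i m n → sub s i (m + n) ≡ sub s i m ++ sub s (i + m) n
  sub-+ i zero    n = cong (λ j → sub s j n) (sym (+-identityʳ i))
  sub-+ i (suc m) n = cong (s i ∷_) (trans (sub-+ (suc i) m n) (cong (λ j → sub s (suc i) m ++ sub s j n) (sym (+-suc i m))))

  sub-snoc : ∀ i n → sub s i (suc n) ≡ sub s i n ++ [ s (i + n) ]
  sub-snoc i n = trans (cong (sub s i) (+-comm 1 n)) (sub-+ i n 1)

  factor-sub : ∀ i n → Factor s (sub s i n)
  factor-sub i n = i , cong (sub s i) (length-sub i n)

  sub-at : ∀ {i j n} → sub s i n ≡ sub s j n → ∀ l → l < n → s (i + l) ≡ s (j + l)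
  sub-at {i} {j} {suc n} e zero    _        =
    trans (cong s (+-identityʳ i)) (trans (∷-injectiveˡ e) (cong s (sym (+-identityʳ j))))
  sub-at {i} {j} {suc n} e (suc l) (s≤s l<n) =
    trans (cong s (+-suc i l)) (trans (sub-at (∷-injectiveʳ e) l l<n) (cong s (sym (+-suc j l))))

  sub-cong : ∀ {i j} n → (∀ l → l < n → s (i + l) ≡ s (j + l)) → sub s i n ≡ sub s j n
  sub-cong zero    h = refl
  sub-cong {i} {j} (suc n) h = cong₂ _∷_
    (trans (cong s (sym (+-identityʳ i))) (trans (h 0 z<s) (cong s (+-identityʳ j))))
    (sub-cong n (λ l l<n → trans (cong s (sym (+-suc i l))) (trans (h (suc l) (s≤s l<n)) (cong s (+-suc j l)))))

  sub-prefix : ∀ {i j m n} → m ≤ n → sub s i n ≡ sub s j n → sub s i m ≡ sub s j m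
  sub-prefix {m = m} m≤n e = sub-cong m (λ l l<m → sub-at e l (≤-trans l<m m≤n))

  revsub : ℕ → ℕ → List (Fin k)
  revsub i zero    = []
  revsub i (suc n) = s (i + n) ∷ revsub i n

  reverse-sub : ∀ i n → reverse (sub s i n) ≡ revsub i n
  reverse-sub i zero    = refl
  reverse-sub i (suc n) = begin
    reverse (sub s i (suc n))          ≡⟨ cong reverse (sub-snoc i n) ⟩
    reverse (sub s i n ++ [ s (i + n) ]) ≡⟨ reverse-++ (sub s i n) [ s (i + n) ] ⟩
    s (i + n) ∷ reverse (sub s i n)    ≡⟨ cong (s (i + n) ∷_) (reverse-sub i n) ⟩
    revsub i (suc n)                   ∎
    where open ≡-Reasoning

  PalAt : ℕ → ℕ → Set
  PalAt i N = ∀ n n′ → suc (n + n′) ≡ N → s (i + n) ≡ s (i + n′)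

  palindrome-at : ∀ {i N} → Palindrome (sub s i N) → PalAt i N
  palindrome-at {i} {N} pal n n′ e = go N i (sym (trans (sym (reverse-sub i N)) pal)) n n′ e
    where
    go : ∀ N j → sub s j N ≡ revsub i N → ∀ n n′ → suc (n + n′) ≡ N → s (j + n) ≡ s (i + n′)
    go (suc N) j e zero    n′ refl = trans (cong s (+-identityʳ j)) (∷-injectiveˡ e)
    go (suc N) j e (suc n) n′ e′   = trans (cong s (+-suc j n)) (go N (suc j) (∷-injectiveʳ e) n n′ (suc-injective e′))

  reverse-in-palindrome : ∀ {i N} → PalAt i N → ∀ a L b → a + L + b ≡ N → reverse (sub s (i + a) L) ≡ sub s (i + b) L
  reverse-in-palindrome {i} {N} pal a L b e = trans (reverse-sub (i + a) L) (go L b e)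
    where
    go : ∀ L b → a + L + b ≡ N → revsub (i + a) L ≡ sub s (i + b) L
    go zero    b e = refl
    go (suc L) b e = cong₂ _∷_
      (trans (cong s (+-assoc i a L)) (pal (a + L) b (trans (cong (_+ b) (sym (+-suc a L))) e)))
      (trans (go L (suc b) (trans (+-suc (a + L) b) (trans (cong (_+ b) (sym (+-suc a L))) e)))
             (cong (λ j → sub s j L) (+-suc i b)))

  at-palindrome : ∀ {i N} → PalAt i N → Palindrome (sub s i N)
  at-palindrome {i} {N} pal = subst (λ j → reverse (sub s j N) ≡ sub s j N) (+-identityʳ i)
    (reverse-in-palindrome pal 0 N 0 (+-identityʳ N))

  -- Complete returns in coordinates: `suc d` is the distance from `i` to the next occurrence of the
  -- palindrome of length `suc L` found at `i`.
  ReturnsPalindromic : ℕ → Set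
  ReturnsPalindromic i = ∀ L d → Palindrome (sub s i (suc L)) → sub s (i + suc d) (suc L) ≡ sub s i (suc L) →
    (∀ d′ → d′ < d → sub s (i + suc d′) (suc L) ≢ sub s i (suc L)) → Palindrome (sub s i (suc d + suc L))

  RichFrom : Fin k → Set
  RichFrom x = ∀ i → s i ≡ x → ReturnsPalindromic i

  module Reversal (rec : Recurrent s) {x : Fin k} (rich : RichFrom x) {o : ℕ} (so : s o ≡ x) where

    -- A palindromic suffix starting after j reoccurs earlier, so the last complete return to it is a longer one.
    extend : ∀ {j ν} → o < j → sub s j (suc ν) ≡ sub s o (suc ν) → s (j + ν) ≡ x →
      ∀ fuel r L → r ≤ fuel → r + suc L ≡ suc (j + ν) → Palindrome (sub s r (suc L)) →
      ∃[ r′ ] ∃[ M ] (r′ ≤ j × r′ + M ≡ suc (j + ν) × Palindrome (sub s r′ M))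
    extend {j} {ν} o<j again end fuel r L r≤ e pal with r ≤? j
    ... | yes r≤j = r , suc L , r≤j , e , pal
    extend {j} {ν} o<j again end zero r L r≤ e pal | no r≰j = ⊥-elim (r≰j (≤-trans r≤ z≤n))
    extend {j} {ν} o<j again end (suc fuel) r L r≤ e pal | no r≰j with least P? δ earlier
      where
      P : ℕ → Set
      P d = sub s (r ∸ suc d) (suc L) ≡ sub s r (suc L)
      P? : ∀ d → Dec (P d)
      P? d = sub s (r ∸ suc d) (suc L) ≟ₗ sub s r (suc L)
      δ = j ∸ suc o
      j<r : j < r
      j<r = ≰⇒> r≰j
      α = r ∸ j
      r≡ : j + α ≡ r
      r≡ = m+[n∸m]≡n (<⇒≤ j<r)
      sucδ : suc δ ≡ j ∸ o
      sucδ = sym (+-∸-assoc 1 o<j)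
      r∸ : r ∸ suc δ ≡ o + α
      r∸ = begin
        r ∸ suc δ           ≡⟨ cong₂ _∸_ (sym r≡) sucδ ⟩
        (j + α) ∸ (j ∸ o)   ≡⟨ cong (λ l → l + α ∸ (j ∸ o)) (sym (m∸n+n≡m (<⇒≤ o<j))) ⟩
        (j ∸ o + o + α) ∸ (j ∸ o) ≡⟨ cong (_∸ (j ∸ o)) (+-assoc (j ∸ o) o α) ⟩
        (j ∸ o + (o + α)) ∸ (j ∸ o) ≡⟨ m+n∸m≡n (j ∸ o) (o + α) ⟩
        o + α               ∎
        where open ≡-Reasoning
      αL : α + suc L ≡ suc ν
      αL = +-cancelˡ-≡ j _ _ (trans (sym (+-assoc j α (suc L))) (trans (cong (_+ suc L) r≡) (trans e (sym (+-suc j ν)))))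
      earlier : P δ
      earlier = trans (cong (λ l → sub s l (suc L)) r∸) (trans (sub-cong (suc L) (λ l l< →
          trans (cong s (+-assoc o α l)) (trans (sym (sub-at again (α + l) (≤-trans (≤-reflexive (sym (+-suc α l))) (≤-trans (+-monoʳ-≤ α l<) (≤-reflexive αL)))))
            (cong s (sym (+-assoc j α l))))))
        (cong (λ l → sub s l (suc L)) r≡))
    ... | d , d≤δ , Pd , below =
        extend o<j again end fuel (r ∸ suc d) (d + suc L) (≤-pred (≤-trans (s≤s (∸-monoʳ-≤ r (s≤s (z≤n {d})))) (s≤s (∸-monoˡ-≤ 1 r≤)))) e′ longer
      where
      j<r : j < r
      j<r = ≰⇒> r≰j
      sd≤r : suc d ≤ r
      sd≤r = ≤-trans (s≤s (≤-trans d≤δ (m∸n≤m j (suc o)))) j<r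
      back : r ∸ suc d + suc d ≡ r
      back = m∸n+n≡m sd≤r
      e′ : r ∸ suc d + suc (d + suc L) ≡ suc (j + ν)
      e′ = trans (sym (+-assoc (r ∸ suc d) (suc d) (suc L))) (trans (cong (_+ suc L) back) e)
      start : s (r ∸ suc d) ≡ x
      start = trans (∷-injectiveˡ Pd) (trans (cong s (sym (+-identityʳ r))) (trans (palindrome-at pal 0 L refl)
                (trans (cong s (suc-injective (trans (sym (+-suc r L)) e))) end)))
      step-back : ∀ d′ → d′ < d → r ∸ suc d + suc d′ ≡ r ∸ suc (d ∸ suc d′)
      step-back d′ d′<d = sym (begin
        r ∸ suc (d ∸ suc d′)                          ≡⟨ cong (_∸ suc (d ∸ suc d′)) (sym back) ⟩
        (r ∸ suc d + suc d) ∸ suc (d ∸ suc d′)        ≡⟨ +-∸-assoc (r ∸ suc d) (s≤s (m∸n≤m d (suc d′))) ⟩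
        r ∸ suc d + (d ∸ (d ∸ suc d′))                ≡⟨ cong (r ∸ suc d +_) (m∸[m∸n]≡n d′<d) ⟩
        r ∸ suc d + suc d′                            ∎)
        where open ≡-Reasoning
      longer : Palindrome (sub s (r ∸ suc d) (suc (d + suc L)))
      longer = rich (r ∸ suc d) start L d (subst Palindrome (sym Pd) pal)
        (trans (cong (λ l → sub s l (suc L)) back) (sym Pd))
        (λ d′ d′<d h → below (d ∸ suc d′) (≤-trans (≤-reflexive (sym (+-∸-assoc 1 d′<d))) (m∸n≤m d d′))
          (trans (cong (λ l → sub s l (suc L)) (sym (step-back d′ d′<d))) (trans h Pd)))

    -- An occurrence of `u` is enclosed in a factor from the `x` at `o` to an `x` at `E`, and that
    -- factor recurs at `j`. Starting from the single letter `x` at the end of this copy, `extend`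
    -- reaches a palindrome covering the whole copy, hence `u`; the mirror image of `u` in it is the
    -- reversal.
    closed-under-reversal : ∀ u → Factor s u → Factor s (reverse u)
    closed-under-reversal u fac with rec u fac o
    ... | i , o≤i , at-i with rec [ x ] (o , cong [_] so) (i + length u)
    ... | E , le , atE with rec (sub s o (suc (E ∸ o))) (factor-sub o _) (suc o)
    ... | j , o<j , again with
      extend o<j again′ end (j + ν) (j + ν) 0 ≤-refl (+-comm (j + ν) 1) refl
      where
      ν = E ∸ o
      o≤E : o ≤ E
      o≤E = ≤-trans o≤i (≤-trans (m≤m+n i (length u)) le)
      again′ : sub s j (suc ν) ≡ sub s o (suc ν)
      again′ = trans (cong (sub s j) (sym (length-sub o (suc ν)))) again
      end : s (j + ν) ≡ x
      end = trans (sub-at again′ ν ≤-refl) (trans (cong s (m+[n∸m]≡n o≤E)) (∷-injectiveˡ atE))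
    ... | r , M , r≤j , e , pal = r + b , trans (cong (sub s (r + b)) (length-reverse u)) (sym rev)
      where
      ν = E ∸ o
      L = length u
      o≤E : o ≤ E
      o≤E = ≤-trans o≤i (≤-trans (m≤m+n i L) le)
      α = i ∸ o
      a = (j ∸ r) + α
      b = M ∸ (a + L)
      ra : r + a ≡ j + α
      ra = trans (sym (+-assoc r (j ∸ r) α)) (cong (_+ α) (m+[n∸m]≡n r≤j))
      αL≤ : α + L ≤ ν
      αL≤ = +-cancelˡ-≤ o _ _ (≤-trans (≤-reflexive (trans (sym (+-assoc o α L)) (cong (_+ L) (m+[n∸m]≡n o≤i)))) (≤-trans le (≤-reflexive (sym (m+[n∸m]≡n o≤E)))))
      aL≤M : a + L ≤ M
      aL≤M = +-cancelˡ-≤ r _ _ (≤-trans (≤-reflexive (trans (sym (+-assoc r a L)) (trans (cong (_+ L) ra) (+-assoc j α L))))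
               (≤-trans (+-monoʳ-≤ j αL≤) (≤-trans (n≤1+n _) (≤-reflexive (sym e)))))
      again′ : sub s j (suc ν) ≡ sub s o (suc ν)
      again′ = trans (cong (sub s j) (sym (length-sub o (suc ν)))) again
      u-at : sub s (r + a) L ≡ u
      u-at = trans (trans (sub-cong L (λ l l<L → trans (cong s (trans (cong (_+ l) ra) (+-assoc j α l)))
          (trans (sub-at again′ (α + l) (s≤s (≤-trans (+-monoʳ-≤ α (<⇒≤ l<L)) αL≤)))
            (cong s (trans (sym (+-assoc o α l)) (cong (_+ l) (m+[n∸m]≡n o≤i)))))))
          refl) at-i
      rev : reverse u ≡ sub s (r + b) L
      rev = trans (cong reverse (sym u-at)) (reverse-in-palindrome (palindrome-at pal) a L b (m+[n∸m]≡n aL≤M))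

  take-sub : ∀ i {n N} → n ≤ N → take n (sub s i N) ≡ sub s i n
  take-sub i z≤n       = refl
  take-sub i (s≤s n≤N) = cong (s i ∷_) (take-sub (suc i) n≤N)

  window-sub : ∀ i p n N → p + n ≤ N → take n (drop p (sub s i N)) ≡ sub s (i + p) n
  window-sub i zero    n N       le       = trans (take-sub i le) (cong (λ j → sub s j n) (sym (+-identityʳ i)))
  window-sub i (suc p) n (suc N) (s≤s le) = trans (window-sub (suc i) p n N le) (cong (λ j → sub s j n) (sym (+-suc i p)))

-- A letter that starts no listed oddity

StartsWith : ∀ {k} → Fin k → List (Fin k) → Set
StartsWith x w = ∃[ v ] w ≡ x ∷ v

startsWith? : ∀ {k} (x : Fin k) w → Dec (StartsWith x w)
startsWith? x []      = no λ ()
startsWith? x (y ∷ w) with y ≟ x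
... | yes refl = yes (w , refl)
... | no ne    = no λ { (_ , e) → ne (∷-injectiveˡ e) }

startsWith-unique : ∀ {k} {x y : Fin k} {w} → StartsWith x w → StartsWith y w → x ≡ y
startsWith-unique (_ , refl) (_ , e) = ∷-injectiveˡ e

-- Otherwise, choosing for every letter a listed word that starts with it would map `Fin k`
-- injectively into fewer than `k` places.
free-letter : ∀ {k} (L : List (List (Fin k))) → length L < k → ∃[ x ] ¬ Any (StartsWith x) L
free-letter {k} L lt = ¬∀⟶∃¬ k (λ x → Any (StartsWith x) L) (λ x → Any.any? (startsWith? x) L) all-used
  where
  all-used : ¬ (∀ x → Any (StartsWith x) L)
  all-used h with pigeonhole lt (λ x → Any.index (h x))
  ... | x , y , x<y , e = <⇒≢′ x<y (startsWith-unique (lookup-index (h x))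
          (subst (λ l → StartsWith y (lookup L l)) (sym e) (lookup-index (h y))))

rich-letter : ∀ {k} (s : Word k) → FewerOdditiesThan s k → ∃[ x ] Factors.RichFrom s x
rich-letter {k} s (Ls , lt , covers) with free-letter Ls lt
... | x , free = x , rich
  where
  open Factors s
  rich : RichFrom x
  rich i si L d pal again before with reverse (sub s i (suc d + suc L)) ≟ₗ sub s i (suc d + suc L)
  ... | yes p = p
  ... | no ¬p with covers w (inj₁ (factor-sub i M , ¬p , u , (λ ()) , factor-sub i (suc L) , pal , return))
    where
    M = suc d + suc L
    u = sub s i (suc L)
    w = sub s i M
    lu : length u ≡ suc L
    lu = length-sub i (suc L)
    lw : length w ≡ M
    lw = length-sub i M
    occ⇒ : ∀ p → OccAt u w p → p + suc L ≤ M × sub s (i + p) (suc L) ≡ u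
    occ⇒ p (le , e) = le′ , trans (sym (window-sub i p (suc L) M le′)) (trans (cong (λ l → take l (drop p w)) (sym lu)) e)
      where
      le′ : p + suc L ≤ M
      le′ = subst₂ (λ a b → p + a ≤ b) lu lw le
    ⇒occ : ∀ p → p + suc L ≤ M → sub s (i + p) (suc L) ≡ u → OccAt u w p
    ⇒occ p le e = subst₂ (λ a b → p + a ≤ b) (sym lu) (sym lw) le ,
      trans (cong (λ l → take l (drop p w)) lu) (trans (window-sub i p (suc L) M le) e)
    end : length w ∸ length u ≡ suc d
    end = trans (cong₂ _∸_ lw lu) (m+n∸n≡m (suc d) (suc L))
    only : ∀ p → OccAt u w p → p ≡ 0 ⊎ p ≡ length w ∸ length u
    only p h with occ⇒ p h
    only zero h    | _ = inj₁ refl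
    only (suc p) h | le , e with m≤n⇒m<n∨m≡n (≤-pred (+-cancelʳ-≤ (suc L) (suc p) (suc d) le))
    ... | inj₁ p<d  = ⊥-elim (before p p<d e)
    ... | inj₂ refl = inj₂ (sym end)
    return : CompleteReturn u w
    return = subst₂ _<_ (sym lu) (sym lw) (s≤s (m≤n+m (suc L) d)) ,
      ⇒occ 0 (m≤n+m (suc L) (suc d)) (cong (λ j → sub s j (suc L)) (+-identityʳ i)) ,
      subst (OccAt u w) (sym end) (⇒occ (suc d) ≤-refl again) , only
  ...   | inj₁ w∈ = ⊥-elim (free (Any.map (λ e → sub s (suc i) (d + suc L) , trans (sym e) (cong (_∷ sub s (suc i) (d + suc L)) si)) w∈))
  -- The list may contain the reversal instead; it starts with the last letter of `w`, which is
  -- again `x`.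
  ...   | inj₂ r∈ = ⊥-elim (free (Any.map (λ e → _ , trans (sym e) starts) r∈))
    where
    final : s (i + (d + suc L)) ≡ x
    final = trans (cong s (trans (cong (i +_) (+-suc d L)) (sym (+-assoc i (suc d) L))))
      (trans (sub-at again L ≤-refl) (trans (sym (palindrome-at pal 0 L refl)) (trans (cong s (+-identityʳ i)) si)))
    starts : reverse (sub s i (suc (d + suc L))) ≡ x ∷ revsub i (d + suc L)
    starts = trans (reverse-sub i (suc (d + suc L))) (cong (_∷ revsub i (d + suc L)) final)

-- Desubstitution by a separating letter

occ-∷ : ∀ {k} (z c : Fin k) w → occ z (c ∷ w) ≡ ind z c + occ z w
occ-∷ z c w with c ≟ z
... | yes _ = refl
... | no _  = refl

module Inflation {k} (y : Fin k) where

  -- The elementary episturmian morphism with letter `y`; from `e₀` on, `s` is the image of `s′`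
  -- under it.
  ψ₁ : Fin k → List (Fin k)
  ψ₁ z with z ≟ y
  ... | yes _ = y ∷ []
  ... | no _  = y ∷ z ∷ []

  ψ₁-≢ : ∀ {z} → z ≢ y → ψ₁ z ≡ y ∷ z ∷ []
  ψ₁-≢ {z} ne with z ≟ y
  ... | yes e = ⊥-elim (ne e)
  ... | no _  = refl

  ψ : List (Fin k) → List (Fin k)
  ψ []      = []
  ψ (z ∷ w) = ψ₁ z ++ ψ w

  ψ-++ : ∀ v w → ψ (v ++ w) ≡ ψ v ++ ψ w
  ψ-++ []      w = refl
  ψ-++ (z ∷ v) w = trans (cong (ψ₁ z ++_) (ψ-++ v w)) (sym (++-assoc (ψ₁ z) (ψ v) (ψ w)))

  -- The closing `y` makes the coding commute with reversal. It also certifies that the last block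
  -- is complete: a final `y` in `ψ w` alone could be the beginning of some `y z`.
  ψy : List (Fin k) → List (Fin k)
  ψy w = ψ w ++ [ y ]

  length-ψy : ∀ w → length (ψy w) ≡ suc (length (ψ w))
  length-ψy w = trans (length-++ (ψ w)) (+-comm (length (ψ w)) 1)

  ψy-head : ∀ w → ∃[ v ] ψy w ≡ y ∷ v
  ψy-head [] = [] , refl
  ψy-head (z ∷ w) with z ≟ y
  ... | yes _ = _ , refl
  ... | no _  = _ , refl

  length-ψ : ∀ w → length w ≤ length (ψ w)
  length-ψ [] = z≤n
  length-ψ (z ∷ w) with z ≟ y
  ... | yes _ = s≤s (length-ψ w)
  ... | no _  = s≤s (m≤n⇒m≤1+n (length-ψ w))

  ψy-injective : ∀ v w → ψy v ≡ ψy w → v ≡ w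
  ψy-injective [] [] e = refl
  ψy-injective [] (z ∷ w) e with z ≟ y
  ... | yes _ with ψy-head w
  ...   | _ , h with () ← trans (∷-injectiveʳ e) h
  ψy-injective [] (z ∷ w) e | no _ with () ← ∷-injectiveʳ e
  ψy-injective (z ∷ v) [] e with z ≟ y
  ... | yes _ with ψy-head v
  ...   | _ , h with () ← trans (sym (∷-injectiveʳ e)) h
  ψy-injective (z ∷ v) [] e | no _ with () ← ∷-injectiveʳ e
  ψy-injective (z ∷ v) (z′ ∷ w) e with z ≟ y | z′ ≟ y
  ... | yes p | yes q = cong₂ _∷_ (trans p (sym q)) (ψy-injective v w (∷-injectiveʳ e))
  ... | no _  | no _  = cong₂ _∷_ (∷-injectiveˡ (∷-injectiveʳ e)) (ψy-injective v w (∷-injectiveʳ (∷-injectiveʳ e)))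
  ... | yes p | no q  = ⊥-elim (q (sym (∷-injectiveˡ (trans (sym (proj₂ (ψy-head v))) (∷-injectiveʳ e)))))
  ... | no p  | yes q = ⊥-elim (p (∷-injectiveˡ (trans (∷-injectiveʳ e) (proj₂ (ψy-head w)))))

  reverse-ψ₁ : ∀ z → [ y ] ++ reverse (ψ₁ z) ≡ ψ₁ z ++ [ y ]
  reverse-ψ₁ z with z ≟ y
  ... | yes _ = refl
  ... | no _  = refl

  reverse-ψy : ∀ w → reverse (ψy w) ≡ ψy (reverse w)
  reverse-ψy [] = refl
  reverse-ψy (z ∷ w) = begin
    reverse ((ψ₁ z ++ ψ w) ++ [ y ])            ≡⟨ cong reverse (++-assoc (ψ₁ z) (ψ w) [ y ]) ⟩
    reverse (ψ₁ z ++ ψy w)                      ≡⟨ reverse-++ (ψ₁ z) (ψy w) ⟩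
    reverse (ψy w) ++ reverse (ψ₁ z)            ≡⟨ cong (_++ reverse (ψ₁ z)) (reverse-ψy w) ⟩
    (ψ (reverse w) ++ [ y ]) ++ reverse (ψ₁ z)  ≡⟨ ++-assoc (ψ (reverse w)) [ y ] (reverse (ψ₁ z)) ⟩
    ψ (reverse w) ++ ([ y ] ++ reverse (ψ₁ z))  ≡⟨ cong (ψ (reverse w) ++_) (reverse-ψ₁ z) ⟩
    ψ (reverse w) ++ (ψ₁ z ++ [ y ])            ≡⟨ ++-assoc (ψ (reverse w)) (ψ₁ z) [ y ] ⟨
    (ψ (reverse w) ++ ψ₁ z) ++ [ y ]            ≡⟨ cong (λ v → (ψ (reverse w) ++ v) ++ [ y ]) (++-identityʳ (ψ₁ z)) ⟨
    (ψ (reverse w) ++ ψ [ z ]) ++ [ y ]         ≡⟨ cong (_++ [ y ]) (ψ-++ (reverse w) [ z ]) ⟨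
    ψy (reverse w ++ [ z ])                     ≡⟨ cong ψy (unfold-reverse z w) ⟨
    ψy (reverse (z ∷ w))                        ∎
    where open ≡-Reasoning

  occ-ψ : ∀ {z} → z ≢ y → ∀ w → occ z (ψ w) ≡ occ z w
  occ-ψ z≢y [] = refl
  occ-ψ {z} z≢y (c ∷ w) = trans (go c) (sym (occ-∷ z c w))
    where
    y≢z : y ≢ z
    y≢z e = z≢y (sym e)
    go : ∀ c → occ z (ψ₁ c ++ ψ w) ≡ ind z c + occ z w
    go c with c ≟ y
    ... | yes refl = trans (occ-∷ z y (ψ w)) (cong (ind z y +_) (occ-ψ z≢y w))
    ... | no _  = trans (occ-∷ z y (c ∷ ψ w)) (trans (cong₂ _+_ (ind-miss y≢z) (occ-∷ z c (ψ w))) (cong (ind z c +_) (occ-ψ z≢y w)))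

  -- Every block contributes one leading `y`, and every letter but `y` one letter more; the second
  -- equation records the length without subtraction.
  occ-ψ-y : ∀ w → occ y (ψ w) ≡ length w × length (ψ w) + occ y w ≡ length w + length w
  occ-ψ-y [] = refl , refl
  occ-ψ-y (c ∷ w) = go c
    where
    ih = occ-ψ-y w
    go : ∀ c → occ y (ψ₁ c ++ ψ w) ≡ suc (length w) × length (ψ₁ c ++ ψ w) + occ y (c ∷ w) ≡ suc (length w) + suc (length w)
    go c with c ≟ y
    ... | yes e = trans (occ-∷ y y (ψ w)) (cong₂ _+_ (ind-hit refl) (proj₁ ih)) ,
      cong suc (trans (+-suc _ (occ y w)) (trans (cong suc (proj₂ ih)) (sym (+-suc (length w) (length w)))))
    ... | no ne = trans (occ-∷ y y (c ∷ ψ w)) (trans (cong₂ _+_ (ind-hit refl) (occ-∷ y c (ψ w))) (cong suc (trans (cong (_+ occ y (ψ w)) (ind-miss ne)) (proj₁ ih)))) ,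
      cong suc (trans (cong suc (proj₂ ih)) (sym (+-suc (length w) (length w))))

module Desubstitution {k} (s : Word k) (rec : Recurrent s) (bal : Balanced s) (y : Fin k)
                      (sep : Counting.Separating s y) {e₀ : ℕ} (se₀ : s e₀ ≡ y) where
  open Inflation y
  open Counting s
  open Factors s

  advance : ℕ → ℕ
  advance p with s (suc p) ≟ y
  ... | yes _ = suc p
  ... | no _  = suc (suc p)

  e : ℕ → ℕ
  e zero    = e₀
  e (suc i) = advance (e i)

  s′ : Word k
  s′ i = s (suc (e i))

  module F′ = Factors s′

  advance-y : ∀ {p} → s (suc p) ≡ y → advance p ≡ suc p
  advance-y {p} h with s (suc p) ≟ y
  ... | yes _ = refl
  ... | no n  = ⊥-elim (n h)

  advance-≢ : ∀ {p} → s (suc p) ≢ y → advance p ≡ suc (suc p)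
  advance-≢ {p} h with s (suc p) ≟ y
  ... | yes e = ⊥-elim (h e)
  ... | no _  = refl

  after-≢ : ∀ {p} → s p ≢ y → s (suc p) ≡ y
  after-≢ {p} n with sep p
  ... | inj₁ h = ⊥-elim (n h)
  ... | inj₂ h = h

  s-advance : ∀ p → s (advance p) ≡ y
  s-advance p with s (suc p) ≟ y
  ... | yes h = h
  ... | no n  = after-≢ n

  s-e : ∀ i → s (e i) ≡ y
  s-e zero    = se₀
  s-e (suc i) = s-advance (e i)

  advance-block : ∀ p → s p ≡ y → ∃[ n ] (length (ψ₁ (s (suc p))) ≡ n × advance p ≡ p + n × sub s p n ≡ ψ₁ (s (suc p)))
  advance-block p h with s (suc p) ≟ y
  ... | yes _ = 1 , refl , +-comm 1 p , cong [_] h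
  ... | no _  = 2 , refl , +-comm 2 p , cong (λ c → c ∷ s (suc p) ∷ []) h

  len : ℕ → ℕ → ℕ
  len i L = length (ψ (sub s′ i L))

  e-+ : ∀ i L → e (i + L) ≡ e i + len i L × sub s (e i) (len i L) ≡ ψ (sub s′ i L)
  e-+ i zero    = trans (cong e (+-identityʳ i)) (sym (+-identityʳ (e i))) , refl
  e-+ i (suc L) with advance-block (e i) (s-e i) | e-+ (suc i) L
  ... | n , ln , adv , blk | p , q =
      trans (cong e (+-suc i L)) (trans p (trans (cong (_+ len (suc i) L) adv) (trans (+-assoc (e i) n _) (cong (e i +_) (sym leq))))) ,
      trans (cong (sub s (e i)) leq) (trans (sub-+ (e i) n (len (suc i) L)) (cong₂ _++_ blk (trans (cong (λ l → sub s l (len (suc i) L)) (sym adv)) q)))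
    where
    leq : len i (suc L) ≡ n + len (suc i) L
    leq = trans (length-++ (ψ₁ (s′ i))) (cong (_+ len (suc i) L) ln)

  encode : ∀ i L → sub s (e i) (suc (len i L)) ≡ ψy (sub s′ i L)
  encode i L = trans (sub-snoc (e i) (len i L)) (cong₂ (λ v c → v ++ [ c ]) (proj₂ (e-+ i L)) (trans (cong s (sym (proj₁ (e-+ i L)))) (s-e (i + L))))

  decode : ∀ u j → sub s (e j) (suc (length (ψ u))) ≡ ψy u → sub s′ j (length u) ≡ u
  decode [] j h = refl
  decode (z ∷ u) j h with z ≟ y
  ... | yes p = cong₂ _∷_ (trans next-y (sym p)) (decode u (suc j) (trans (cong (λ l → sub s l (suc (length (ψ u)))) (advance-y next-y)) (∷-injectiveʳ h)))
    where
    next-y : s (suc (e j)) ≡ y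
    next-y = ∷-injectiveˡ (trans (∷-injectiveʳ h) (proj₂ (ψy-head u)))
  ... | no n = cong₂ _∷_ hz (decode u (suc j) (trans (cong (λ l → sub s l (suc (length (ψ u)))) (advance-≢ (λ q → n (trans (sym hz) q)))) (∷-injectiveʳ (∷-injectiveʳ h))))
    where
    hz : s (suc (e j)) ≡ z
    hz = ∷-injectiveˡ (∷-injectiveʳ h)

  advance-> : ∀ p → p < advance p
  advance-> p with s (suc p) ≟ y
  ... | yes _ = ≤-refl
  ... | no _  = n≤1+n _

  e-mono : ∀ {i j} → i ≤ j → e i ≤ e j
  e-mono {i} {j} i≤j = ≤-trans (m≤m+n (e i) (len i (j ∸ i))) (≤-reflexive (trans (sym (proj₁ (e-+ i (j ∸ i)))) (cong e (m+[n∸m]≡n i≤j))))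

  e-cancel-< : ∀ {i j} → e i < e j → i < j
  e-cancel-< {i} {j} h with i <? j
  ... | yes p = p
  ... | no n  = ⊥-elim (<⇒≱ h (e-mono (≮⇒≥ n)))

  e-cancel-≤ : ∀ {i j} → e i ≤ e j → i ≤ j
  e-cancel-≤ {i} {j} h with i ≤? j
  ... | yes p = p
  ... | no n  = ⊥-elim (<⇒≱ (≤-trans (advance-> (e j)) (e-mono (≰⇒> n))) h)

  locate : ∀ d → (∃[ j ] e j ≡ e₀ + d) ⊎ (∃[ j ] (suc (e j) ≡ e₀ + d × s (e₀ + d) ≢ y))
  locate zero = inj₁ (0 , sym (+-identityʳ e₀))
  locate (suc d) with locate d
  ... | inj₂ (j , p , n) = inj₁ (suc j , trans (advance-≢ (λ h → n (trans (cong s (sym p)) h))) (trans (cong suc p) (sym (+-suc e₀ d))))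
  ... | inj₁ (j , p) with s (suc (e j)) ≟ y
  ...   | yes h = inj₁ (suc j , trans (advance-y h) (trans (cong suc p) (sym (+-suc e₀ d))))
  ...   | no n  = inj₂ (j , trans (cong suc p) (sym (+-suc e₀ d)) , λ h → n (trans (cong s (trans (cong suc p) (sym (+-suc e₀ d)))) h))

  rank : ∀ {p} → e₀ ≤ p → s p ≡ y → ∃[ j ] e j ≡ p
  rank {p} le h with locate (p ∸ e₀)
  ... | inj₁ (j , q)     = j , trans q (m+[n∸m]≡n le)
  ... | inj₂ (j , _ , n) = ⊥-elim (n (trans (cong s (m+[n∸m]≡n le)) h))

  recurrent′ : Recurrent s′
  recurrent′ u (i , at) m with rec (ψy u) (e i , trans (cong (sub s (e i)) (length-ψy u))
      (subst (λ v → sub s (e i) (suc (length (ψ v))) ≡ ψy v) at (encode i (length u)))) (e m)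
  ... | p , le , at-p = finish (rank (≤-trans (e-mono {0} {m} z≤n) le) (∷-injectiveˡ (trans at-p′ (proj₂ (ψy-head u)))))
    where
    at-p′ : sub s p (suc (length (ψ u))) ≡ ψy u
    at-p′ = trans (cong (sub s p) (sym (length-ψy u))) at-p
    finish : ∃[ j ] e j ≡ p → ∃[ j ] (m ≤ j × sub s′ j (length u) ≡ u)
    finish (j , refl) = j , e-cancel-≤ le , decode u j at-p′

  module C′ = Counting s′

  C-len : ∀ {z} → z ≢ y → ∀ i m → C z (e i) (len i m) ≡ C′.C z i m
  C-len {z} z≢y i m = begin
    C z (e i) (len i m)             ≡⟨ C-occ z (e i) (len i m) ⟩
    occ z (sub s (e i) (len i m))   ≡⟨ cong (occ z) (proj₂ (e-+ i m)) ⟩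
    occ z (ψ (sub s′ i m))          ≡⟨ occ-ψ z≢y (sub s′ i m) ⟩
    occ z (sub s′ i m)              ≡⟨ C′.C-occ z i m ⟨
    C′.C z i m                      ∎
    where open ≡-Reasoning

  C-len-y : ∀ i m → C y (e i) (len i m) ≡ m
  C-len-y i m = trans (C-occ y (e i) (len i m)) (trans (cong (occ y) (proj₂ (e-+ i m))) (trans (proj₁ (occ-ψ-y (sub s′ i m))) (F′.length-sub i m)))

  len-y : ∀ i m → len i m + C′.C y i m ≡ m + m
  len-y i m = trans (cong (len i m +_) (C′.C-occ y i m)) (trans (proj₂ (occ-ψ-y (sub s′ i m))) (cong₂ _+_ (F′.length-sub i m) (F′.length-sub i m)))

  -- More `y`'s give a shorter image. With counts two apart, the image at `i` followed by its
  -- closing `y` has `suc m` occurrences of `y`, while the image at `j` without its first letter is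
  -- at least as long and has only `m ∸ 1`.
  balanced-y : ∀ i j m → C′.C y i m ≤ suc (C′.C y j m)
  balanced-y i j m with C′.C y i m ≤? suc (C′.C y j m)
  ... | yes h = h
  ... | no n  = ⊥-elim (1+n≰n (begin
      suc (suc (C y (suc (e j)) lg))  ≡⟨ cong suc rest ⟩
      suc m                           ≡⟨ more ⟨
      C y (e i) (suc (len i m))       ≤⟨ C-bal bal y (e i) (suc (e j)) (suc (len i m)) ⟩
      suc (C y (suc (e j)) (suc (len i m))) ≤⟨ s≤s (C-mono y (suc (e j)) shorter) ⟩
      suc (C y (suc (e j)) lg)        ∎))
    where
    open ≤-Reasoning
    longer : suc (suc (len i m)) ≤ len j m
    longer = +-cancelʳ-≤ (C′.C y j m) _ _ (begin
      suc (suc (len i m)) + C′.C y j m   ≡⟨ lem (len i m) (C′.C y j m) ⟩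
      len i m + suc (suc (C′.C y j m))   ≤⟨ +-monoʳ-≤ (len i m) (≰⇒> n) ⟩
      len i m + C′.C y i m               ≡⟨ trans (len-y i m) (sym (len-y j m)) ⟩
      len j m + C′.C y j m               ∎)
      where
      lem : ∀ a b → suc (suc a) + b ≡ a + suc (suc b)
      lem = solve-∀
    lg : ℕ
    lg = len j m ∸ 1
    lg≡ : suc lg ≡ len j m
    lg≡ = m+[n∸m]≡n {1} (≤-trans (s≤s z≤n) longer)
    shorter : suc (len i m) ≤ lg
    shorter = ∸-monoˡ-≤ 1 longer
    rest : suc (C y (suc (e j)) lg) ≡ m
    rest = trans (cong (_+ C y (suc (e j)) lg) (sym (ind-hit (s-e j)))) (trans (sym (C-suc y (e j) lg)) (trans (cong (C y (e j)) lg≡) (C-len-y j m)))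
    more : C y (e i) (suc (len i m)) ≡ suc m
    more = trans (C-snoc y (e i) (len i m)) (trans (cong₂ _+_ (C-len-y i m) (ind-hit (trans (cong s (sym (proj₁ (e-+ i m)))) (s-e (i + m))))) (+-comm m 1))

  balanced-≢ : ∀ {z} → z ≢ y → ∀ i j m → C′.C z i m ≤ suc (C′.C z j m)
  balanced-≢ {z} z≢y i j m with len i m ≤? len j m
  ... | yes h = begin
      C′.C z i m                      ≡⟨ C-len z≢y i m ⟨
      C z (e i) (len i m)             ≤⟨ C-bal bal z (e i) (e j) (len i m) ⟩
      suc (C z (e j) (len i m))       ≤⟨ s≤s (C-mono z (e j) h) ⟩
      suc (C z (e j) (len j m))       ≡⟨ cong suc (C-len z≢y j m) ⟩
      suc (C′.C z j m)                ∎
    where open ≤-Reasoning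
  ... | no n = begin
      C′.C z i m                      ≡⟨ C-len z≢y i m ⟨
      C z (e i) (len i m)             ≡⟨ cong (C z (e i)) one-more ⟩
      C z (e i) (suc (len j m))       ≡⟨ C-suc z (e i) (len j m) ⟩
      ind z (s (e i)) + C z (suc (e i)) (len j m) ≡⟨ cong (_+ C z (suc (e i)) (len j m)) (ind-miss (λ h → z≢y (trans (sym h) (s-e i)))) ⟩
      C z (suc (e i)) (len j m)       ≤⟨ C-bal bal z (suc (e i)) (e j) (len j m) ⟩
      suc (C z (e j) (len j m))       ≡⟨ cong suc (C-len z≢y j m) ⟩
      suc (C′.C z j m)                ∎
    where
    open ≤-Reasoning
    one-more : len i m ≡ suc (len j m)
    one-more = ≤-antisym (+-cancelʳ-≤ (C′.C y i m) _ _ (begin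
        len i m + C′.C y i m          ≡⟨ trans (len-y i m) (sym (len-y j m)) ⟩
        len j m + C′.C y j m          ≤⟨ +-monoʳ-≤ (len j m) (balanced-y j i m) ⟩
        len j m + suc (C′.C y i m)    ≡⟨ +-suc (len j m) _ ⟩
        suc (len j m) + C′.C y i m    ∎)) (≰⇒> n)

  balanced′ : Balanced s′
  balanced′ i j m z = subst₂ _≤_ (C′.C-occ z i m) (trans (cong suc (C′.C-occ z j m)) (+-comm 1 _)) (go (z ≟ y))
    where
    go : Dec (z ≡ y) → C′.C z i m ≤ suc (C′.C z j m)
    go (yes refl) = balanced-y i j m
    go (no z≢y)   = balanced-≢ z≢y i j m

  -- Occurrences of `ψy u` start at some `e j` and decode there, so complete returns to `u` in `s′`
  -- match those to `ψy u` in `s`. As `u` starts with `x ≢ y`, `ψy u` starts with `y x` and has at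
  -- least three letters. The hypothesis concerns only such palindromes, so that it can be drawn
  -- either from `y` or from `x`.
  rich′ : ∀ {x} → x ≢ y →
    (∀ i → s i ≡ y → s (suc i) ≡ x → ∀ L d → let M = 3 + L in Palindrome (sub s i M) → sub s (i + suc d) M ≡ sub s i M →
      (∀ d′ → d′ < d → sub s (i + suc d′) M ≢ sub s i M) → Palindrome (sub s i (suc d + M))) →
    F′.RichFrom x
  rich′ {x} x≢y rich i si L d pal again before = ψy-injective _ _ (trans (sym (reverse-ψy w)) (trans (cong reverse (sym w-at)) (trans long w-at)))
    where
    u = sub s′ i (suc L)
    w = sub s′ i (suc d + suc L)
    ℓ = len i (suc L)
    L₀ = len (suc i) L
    ℓ≡ : ℓ ≡ 2 + L₀
    ℓ≡ = trans (length-++ (ψ₁ (s′ i))) (cong (λ v → length v + L₀) (ψ₁-≢ (λ h → x≢y (trans (sym si) h))))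
    D = len i (suc d) ∸ 1
    D≡ : suc D ≡ len i (suc d)
    D≡ = m+[n∸m]≡n {1} (≤-trans (s≤s z≤n) (≤-trans (≤-reflexive (sym (F′.length-sub i (suc d)))) (length-ψ (sub s′ i (suc d)))))
    at-D : e i + suc D ≡ e (i + suc d)
    at-D = trans (cong (e i +_) D≡) (sym (proj₁ (e-+ i (suc d))))
    u-at : sub s (e i) (suc ℓ) ≡ ψy u
    u-at = encode i (suc L)
    u-at₃ : sub s (e i) (3 + L₀) ≡ ψy u
    u-at₃ = trans (cong (λ l → sub s (e i) (suc l)) (sym ℓ≡)) u-at
    pal-u : Palindrome (ψy u)
    pal-u = trans (reverse-ψy u) (cong ψy pal)
    again-s : sub s (e i + suc D) (3 + L₀) ≡ sub s (e i) (3 + L₀)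
    again-s = trans (cong₂ (λ a b → sub s a (suc b)) at-D (trans (sym ℓ≡) (cong (λ v → length (ψ v)) (sym again))))
      (trans (encode (i + suc d) (suc L)) (trans (cong ψy again) (sym u-at₃)))
    before-s : ∀ d′ → d′ < D → sub s (e i + suc d′) (3 + L₀) ≢ sub s (e i) (3 + L₀)
    before-s d′ d′<D h = finish (rank (≤-trans (e-mono {0} {i} z≤n) (m≤m+n (e i) (suc d′))) (trans (∷-injectiveˡ h) (s-e i)))
      where
      finish : ∃[ j ] e j ≡ e i + suc d′ → ⊥
      finish (j , ej) = before (j ∸ suc i) j<d (trans (cong (λ l → sub s′ l (suc L)) j≡) (trans (cong (sub s′ j) (sym (F′.length-sub i (suc L)))) (decode u j dec)))
        where
        i<j : i < j
        i<j = e-cancel-< (≤-trans (m<m+n (e i) z<s) (≤-reflexive (sym ej)))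
        j< : j < i + suc d
        j< = e-cancel-< (≤-trans (≤-reflexive (cong suc ej)) (≤-trans (+-monoʳ-< (e i) (s≤s d′<D)) (≤-reflexive at-D)))
        j≡ : i + suc (j ∸ suc i) ≡ j
        j≡ = trans (+-suc i _) (m+[n∸m]≡n i<j)
        j<d : j ∸ suc i < d
        j<d = ≤-pred (+-cancelˡ-< i _ _ (≤-trans (≤-reflexive (cong suc j≡)) j<))
        dec : sub s (e j) (suc (length (ψ u))) ≡ ψy u
        dec = trans (cong₂ (λ a b → sub s a (suc b)) ej ℓ≡) (trans h u-at₃)
    long : Palindrome (sub s (e i) (suc D + (3 + L₀)))
    long = rich (e i) (s-e i) si L₀ D (subst Palindrome (sym u-at₃) pal-u) again-s before-s
    w-at : sub s (e i) (suc D + (3 + L₀)) ≡ ψy w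
    w-at = trans (cong (sub s (e i)) eq) (encode i (suc d + suc L))
      where
      eq : suc D + (3 + L₀) ≡ suc (len i (suc d + suc L))
      eq = trans (+-suc (suc D) (2 + L₀)) (cong suc (trans (cong₂ _+_ D≡ (trans (sym ℓ≡) (cong (λ v → length (ψ v)) (sym again))))
        (trans (sym (length-++ (ψ (sub s′ i (suc d))))) (cong length (trans (sym (ψ-++ (sub s′ i (suc d)) (sub s′ (i + suc d) (suc L)))) (cong ψ (sym (F′.sub-+ i (suc d) (suc L)))))))))

  len-suc : ∀ i L → len i (suc L) ≡ length (ψ₁ (s′ i)) + len (suc i) L
  len-suc i L = length-++ (ψ₁ (s′ i))

  -- Without its leading `y`, the image of `z w z` has length `3 + length (ψ₁ w)` and two `z`'s. The
  -- image of the two letters at `i`, closed by the next `y`, is a window of the same length without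
  -- `z`.
  spread-clash : ∀ {z w i j} → z ≢ y → s′ i ≢ z → s′ (suc i) ≢ z →
    s′ j ≡ z → s′ (1 + j) ≡ w → s′ (2 + j) ≡ z →
    length (ψ₁ (s′ i)) + length (ψ₁ (s′ (suc i))) ≡ 2 + length (ψ₁ w) → ⊥
  spread-clash {z} {w} {i} {j} z≢y n₁ n₂ h₀ h₁ h₂ ℓ = 1+n≰n (begin
      2                                ≤⟨ C′.C-two z j 1 h₀ (trans (cong s′ (+-comm j 2)) h₂) ⟩
      C′.C z j 3                       ≡⟨ C-len z≢y j 3 ⟨
      C z (e j) (len j 3)              ≡⟨ cong (C z (e j)) len-j ⟩
      C z (e j) (suc W)                ≡⟨ C-suc z (e j) W ⟩
      ind z (s (e j)) + C z (suc (e j)) W ≡⟨ cong (_+ C z (suc (e j)) W) (ind-miss (λ h → z≢y (trans (sym h) (s-e j)))) ⟩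
      C z (suc (e j)) W                ≤⟨ C-bal bal z (suc (e j)) (e i) W ⟩
      suc (C z (e i) W)                ≡⟨ cong suc none ⟩
      1                                ∎)
    where
    open ≤-Reasoning
    W : ℕ
    W = 3 + length (ψ₁ w)
    len-z : ∀ i → s′ i ≡ z → length (ψ₁ (s′ i)) ≡ 2
    len-z i h = cong length (ψ₁-≢ (λ h′ → z≢y (trans (sym h) h′)))
    len-j : len j 3 ≡ suc W
    len-j = trans (len-suc j 2) (trans (cong₂ _+_ (len-z j h₀) (trans (len-suc (suc j) 1) (cong₂ _+_ (cong (λ c → length (ψ₁ c)) h₁) (trans (len-suc (2 + j) 0) (cong (_+ 0) (len-z (2 + j) h₂))))))
      (cong (2 +_) (+-comm (length (ψ₁ w)) 2)))
    len-i : len i 2 ≡ 2 + length (ψ₁ w)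
    len-i = trans (len-suc i 1) (trans (cong (length (ψ₁ (s′ i)) +_) (trans (len-suc (suc i) 0) (+-identityʳ _))) ℓ)
    none : C z (e i) W ≡ 0
    none = trans (cong (λ l → C z (e i) (suc l)) (sym len-i)) (trans (C-snoc z (e i) (len i 2))
      (cong₂ _+_ (trans (C-len z≢y i 2) (C′.C-none z i 2 miss)) (ind-miss (λ h → z≢y (trans (sym h) (trans (cong s (sym (proj₁ (e-+ i 2)))) (s-e (i + 2))))))))
      where
      miss : ∀ l → l < 2 → s′ (i + l) ≢ z
      miss 0 _ h = n₁ (trans (cong s′ (sym (+-identityʳ i))) h)
      miss 1 _ h = n₂ (trans (cong s′ (+-comm 1 i)) h)
      miss (suc (suc l)) (s≤s (s≤s ()))

  -- If `u ≢ y`, the images of `u t u` and of `x t` clash over `u`; if `u ≡ y`, those of `t u t` and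
  -- of `u x` clash over `t`. The lengths fit because `x ≢ y` has an image of length two.
  no-alternation : ∀ {x u t} → x ≢ y → XBlocks.Alternation s′ balanced′ recurrent′ x u t → ⊥
  no-alternation {x} {u} {t} x≢y alt = go (u ≟ y)
    where
    open XBlocks.Alternation alt
    len-x : ∀ {c} → c ≡ x → length (ψ₁ c) ≡ 2
    len-x h = cong length (ψ₁-≢ (λ h′ → x≢y (trans (sym h) h′)))
    go : Dec (u ≡ y) → ⊥
    go (no u≢y) with uxtu | utu
    ... | i , _ , h₁ , h₂ , _ | j , g₀ , g₁ , g₂ =
      spread-clash {i = suc i} {j} u≢y (λ h → u≢x (trans (sym h) h₁)) (λ h → u≢t (trans (sym h) h₂)) g₀ g₁ g₂
        (cong₂ _+_ (len-x h₁) (cong (λ c → length (ψ₁ c)) h₂))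
    go (yes u≡y) with tuxt | tut
    ... | i , _ , h₁ , h₂ , _ | j , g₀ , g₁ , g₂ =
      spread-clash {i = suc i} {j} (λ h → u≢t (trans u≡y (sym h))) (λ h → u≢t (trans (sym h₁) h)) (λ h → t≢x (trans (sym h) h₂)) g₀ g₁ g₂
        (trans (cong₂ _+_ (cong (λ c → length (ψ₁ c)) h₁) (len-x h₂)) (+-comm _ 2))

  before-≢ : ∀ {p} → s (suc p) ≢ y → s p ≡ y
  before-≢ {p} n with sep p
  ... | inj₁ h = h
  ... | inj₂ h = ⊥-elim (n h)

  -- The palindrome is `y v y` with `v` starting and ending with `x ≢ y`. As `y` is separating,
  -- every occurrence of `v` has a `y` after it, and one before it unless it opens the word; so the
  -- complete returns are those to `v`, padded by `y`.
  rich-padded : ∀ {x} → x ≢ y → RichFrom x →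
    ∀ i → s i ≡ y → s (suc i) ≡ x → ∀ L d → let M = 3 + L in Palindrome (sub s i M) → sub s (i + suc d) M ≡ sub s i M →
      (∀ d′ → d′ < d → sub s (i + suc d′) M ≢ sub s i M) → Palindrome (sub s i (suc d + M))
  rich-padded {x} x≢y rich i si sx L d pal again before = at-palindrome outer
    where
    palᵢ : PalAt i (3 + L)
    palᵢ = palindrome-at pal
    inner-at : ∀ {j} → sub s j (3 + L) ≡ sub s i (3 + L) → sub s (suc j) (suc L) ≡ sub s (suc i) (suc L)
    inner-at h = sub-prefix (n≤1+n (suc L)) (∷-injectiveʳ h)
    inner-pal : Palindrome (sub s (suc i) (suc L))
    inner-pal = at-palindrome (λ n n′ eq → trans (cong s (sym (+-suc i n))) (trans (palᵢ (suc n) (suc n′)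
      (cong (λ l → suc (suc l)) (trans (+-suc n n′) eq))) (cong s (+-suc i n′))))
    sl : s (suc i + L) ≡ x
    sl = trans (sym (palindrome-at inner-pal 0 L refl)) (trans (cong s (+-identityʳ (suc i))) sx)
    send : s (i + (2 + L)) ≡ y
    send = trans (sym (palᵢ 0 (2 + L) refl)) (trans (cong s (+-identityʳ i)) si)
    pad : ∀ j → sub s (suc j) (suc L) ≡ sub s (suc i) (suc L) → sub s j (3 + L) ≡ sub s i (3 + L)
    pad j h = cong₂ _∷_ (trans (before-≢ (λ w → x≢y (trans (sym sx) (trans (sym (∷-injectiveˡ h)) w)))) (sym si))
      (trans (sub-snoc (suc j) (suc L)) (trans (cong₂ (λ v c → v ++ [ c ]) h
        (trans (trans (cong s (+-suc (suc j) L)) (after-≢ (λ w → x≢y (trans (sym sl) (trans (sym (sub-at h L ≤-refl)) w)))))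
               (sym (trans (cong s (sym (+-suc i (suc L)))) send))))
        (sym (sub-snoc (suc i) (suc L)))))
    long : PalAt (suc i) (suc d + suc L)
    long = palindrome-at (rich (suc i) sx L d inner-pal (inner-at again)
      (λ d′ d′<d h → before d′ d′<d (pad (i + suc d′) h)))
    end : s (i + (suc d + (2 + L))) ≡ y
    end = trans (cong s (sym (+-assoc i (suc d) (2 + L)))) (trans (sub-at again (2 + L) ≤-refl) send)
    outer : PalAt i (suc d + (3 + L))
    outer zero n′ eq = trans (cong s (+-identityʳ i)) (trans si (sym (trans (cong (λ l → s (i + l)) (trans (suc-injective eq) (+-suc d (2 + L)))) end)))
    outer (suc n) zero eq = trans (trans (cong (λ l → s (i + l)) (trans (trans (sym (+-identityʳ (suc n))) (suc-injective eq)) (+-suc d (2 + L)))) end)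
      (sym (trans (cong s (+-identityʳ i)) si))
    outer (suc n) (suc n′) eq = trans (cong s (+-suc i n)) (trans (long n n′ eq′) (cong s (sym (+-suc i n′))))
      where
      eq′ : suc (n + n′) ≡ suc d + suc L
      eq′ = suc-injective (suc-injective (trans (cong (λ l → suc (suc l)) (sym (+-suc n n′))) (trans eq (lem d L))))
        where
        lem : ∀ d L → suc d + (3 + L) ≡ suc (suc (suc d + suc L))
        lem = solve-∀

-- Pairs of right special factors under desubstitution

BadPair : ∀ {k} → Word k → List (Fin k) → Set
BadPair s q = ∃[ a ] ∃[ b ] (a ≢ b × RightSpecial s (a ∷ q) × RightSpecial s (b ∷ q))

module Extensions {k} (s : Word k) where
  open Factors s

  Extended : Fin k → List (Fin k) → Fin k → ℕ → Set
  Extended a q c p = s p ≡ a × sub s (suc p) (length q) ≡ q × s (suc p + length q) ≡ c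

  extended : ∀ {a q c p} → sub s p (length (a ∷ q ++ [ c ])) ≡ a ∷ q ++ [ c ] → Extended a q c p
  extended {a} {q} {c} {p} h = ∷-injectiveˡ h , proj₁ parts , proj₂ parts
    where
    parts : sub s (suc p) (length q) ≡ q × s (suc p + length q) ≡ c
    parts = ∷ʳ-injective _ q (trans (sym (sub-snoc (suc p) (length q)))
      (trans (cong (sub s (suc p)) (sym (trans (length-++ q) (+-comm (length q) 1)))) (∷-injectiveʳ h)))

  extended⇒factor : ∀ {a q c p} → Extended a q c p → Factor s (a ∷ q ++ [ c ])
  extended⇒factor {a} {q} {c} {p} (h₁ , h₂ , h₃) = p , cong₂ _∷_ h₁
    (trans (cong (sub s (suc p)) (trans (length-++ q) (+-comm (length q) 1)))
      (trans (sub-snoc (suc p) (length q)) (cong₂ (λ v d → v ++ [ d ]) h₂ h₃)))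

  occurs-late : Recurrent s → ∀ {a q c} → Factor s (a ∷ q ++ [ c ]) → ∀ m → ∃[ p ] (m ≤ p × Extended a q c p)
  occurs-late rec {a} {q} {c} f m with rec (a ∷ q ++ [ c ]) f m
  ... | p , m≤p , h = p , m≤p , extended h

module BadTransfer {k} (s : Word k) (rec : Recurrent s) (bal : Balanced s) (y : Fin k)
                   (sep : Counting.Separating s y) {e₀ : ℕ} (se₀ : s e₀ ≡ y) where
  open Inflation y
  open Desubstitution s rec bal y sep se₀
  open Factors s
  open Extensions s
  module E′ = Extensions s′

  factor′ : ∀ {a c} q′ → Factor s (a ∷ ψy q′ ++ [ c ]) → Factor s′ (a ∷ q′ ++ [ c ])
  factor′ {a} {c} q′ f with occurs-late rec {q = ψy q′} f (suc e₀)
  ... | p , e₀<p , h₁ , h₂ , h₃ = finish (rank (≤-trans (n≤1+n e₀) (m≤n⇒m≤1+n e₀<p)) (∷-injectiveˡ (trans at-p (proj₂ (ψy-head q′)))))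
    where
    at-p : sub s (suc p) (suc (length (ψ q′))) ≡ ψy q′
    at-p = trans (cong (sub s (suc p)) (sym (length-ψy q′))) h₂
    finish : ∃[ j ] e j ≡ suc p → Factor s′ (a ∷ q′ ++ [ c ])
    finish (zero , refl) = ⊥-elim (1+n≰n (≤-trans (n≤1+n _) e₀<p))
    finish (suc j , ej) = E′.extended⇒factor {q = q′} {p = j} (first , dec , last′)
      where
      first : s′ j ≡ a
      first with s (suc (e j)) ≟ y
      -- If `s′ j` is `y`, the letter just before position `e (suc j)` is the `y` at `e j` itself.
      ... | yes h = trans h (trans (sym (s-e j)) (trans (cong s (suc-injective ej)) h₁))
      ... | no _  = trans (cong s (suc-injective ej)) h₁
      dec : sub s′ (suc j) (length q′) ≡ q′
      dec = decode q′ (suc j) (trans (cong (λ l → sub s l (suc (length (ψ q′)))) ej) at-p)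
      last′ : s′ (suc j + length q′) ≡ c
      last′ = trans (cong s (trans (cong suc (trans (proj₁ (e-+ (suc j) (length q′))) (cong₂ _+_ ej (cong (λ v → length (ψ v)) dec))))
          (trans (sym (+-suc (suc p) (length (ψ q′)))) (cong (suc p +_) (sym (length-ψy q′)))))) h₃

  inflated : ∀ p l → e₀ ≤ p → s p ≡ y → s (p + l) ≡ y → ∃[ q′ ] sub s p (suc l) ≡ ψy q′
  inflated p l le h h′ with rank le h | rank (≤-trans le (m≤m+n p l)) h′
  ... | j , refl | j₂ , ej₂ = sub s′ j L , trans (cong (λ l → sub s (e j) (suc l)) l≡) (encode j L)
    where
    L = j₂ ∸ j
    j≤ : j ≤ j₂
    j≤ = e-cancel-≤ (≤-trans (m≤m+n (e j) l) (≤-reflexive (sym ej₂)))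
    l≡ : l ≡ len j L
    l≡ = +-cancelˡ-≡ (e j) _ _ (trans (sym ej₂) (trans (cong e (sym (m+[n∸m]≡n j≤))) (proj₁ (e-+ j L))))

  -- Any letter other than `y` can only be followed by `y`, so it cannot end a right special factor.
  special-last : ∀ {a q p} → RightSpecial s (a ∷ q) → s p ≡ a → sub s (suc p) (length q) ≡ q → s (p + length q) ≡ y
  special-last {a} {q} {p} (c , c′ , c≢c′ , f , f′) h₁ h₂ with s (p + length q) ≟ y
  ... | yes h = h
  ... | no n  = ⊥-elim (c≢c′ (trans (next-y f) (sym (next-y f′))))
    where
    next-y : ∀ {c} → Factor s (a ∷ q ++ [ c ]) → c ≡ y
    next-y f with occurs-late rec {q = q} f 0
    ... | p₂ , _ , g₁ , g₂ , g₃ = trans (sym g₃) (after-≢ (λ h → n (trans (sym (sub-at {p₂} {p} {suc (length q)}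
            (cong₂ _∷_ (trans g₁ (sym h₁)) (trans g₂ (sym h₂))) (length q) ≤-refl)) h)))

  bad′ : ∀ q → BadPair s q → ∃[ q′ ] (length q′ < length q × BadPair s′ q′)
  bad′ q (a , b , a≢b , ra@(c , c′ , c≢c′ , f , f′) , rb@(d , d′ , d≢d′ , g , g′))
    with occurs-late rec {q = q} f (suc e₀) | occurs-late rec {q = q} g (suc e₀)
  ... | p , e₀<p , h₁ , h₂ , _ | p₂ , _ , k₁ , k₂ , _ = go q refl
    where
    ends : s (p + length q) ≡ y
    ends = special-last ra h₁ h₂
    ends₂ : s (p₂ + length q) ≡ y
    ends₂ = special-last rb k₁ k₂
    go : ∀ w → w ≡ q → ∃[ q′ ] (length q′ < length q × BadPair s′ q′)
    -- For empty `q` the last letters are `a` and `b` themselves, and both would be `y`.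
    go [] refl = ⊥-elim (a≢b (trans (trans (sym h₁) (trans (cong s (sym (+-identityʳ p))) ends))
                          (sym (trans (sym k₁) (trans (cong s (sym (+-identityʳ p₂))) ends₂)))))
    go (z ∷ w) refl with inflated (suc p) (length w) (≤-trans (n≤1+n e₀) (m≤n⇒m≤1+n e₀<p)) starts (trans (cong s (sym (+-suc p (length w)))) ends)
      where
      starts : s (suc p) ≡ y
      starts with a ≟ y
      ... | no n = after-≢ (λ h → n (trans (sym h₁) h))
      -- If `a` is `y` then `b` is not, and the first letter of `q`, which also follows `b`, must be
      -- `y`.
      ... | yes h = trans (∷-injectiveˡ h₂) (trans (sym (∷-injectiveˡ k₂)) (after-≢ (λ h′ → a≢b (trans h (sym (trans (sym k₁) h′))))))
    ... | q′ , eq = q′ , shorter , a , b , a≢b , (c , c′ , c≢c′ , tr f , tr f′) , (d , d′ , d≢d′ , tr g , tr g′)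
      where
      q≡ : z ∷ w ≡ ψy q′
      q≡ = trans (sym h₂) eq
      tr : ∀ {a c} → Factor s (a ∷ (z ∷ w) ++ [ c ]) → Factor s′ (a ∷ q′ ++ [ c ])
      tr {a} {c} f = factor′ q′ (subst (λ v → Factor s (a ∷ v ++ [ c ])) q≡ f)
      shorter : length q′ < suc (length w)
      shorter = ≤-trans (s≤s (length-ψ q′)) (≤-reflexive (sym (trans (cong length q≡) (length-ψy q′))))

-- Right special factors and the theorem

-- A block together with the `x`'s around it is a complete return to the one-letter palindrome `x`.
rich⇒palindromic-returns : ∀ {k} (s : Word k) (bal : Balanced s) (rec : Recurrent s) {x : Fin k} → Factors.RichFrom s x →
  XBlocks.PalindromicReturns s bal rec x
rich⇒palindromic-returns s bal rec rich p N sp (hit , miss) n n′ e =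
  trans (cong s (sym (+-suc p n))) (trans (palindrome-at (rich p sp 0 N refl
      (cong [_] (trans hit (sym sp)))
      (λ d d<N h → miss d d<N (trans (cong s (sym (+-suc p d))) (trans (∷-injectiveˡ h) sp))))
    (suc n) (suc n′) (trans (cong (λ l → suc (suc l)) (trans (+-suc n n′) e)) (+-comm 1 (suc N))))
  (cong s (+-suc p n′)))
  where open Factors s

record Desubstituted {k} (s : Word k) (y : Fin k) : Set where
  field
    s′ : Word k
    recurrent′ : Recurrent s′
    balanced′ : Balanced s′
    no-alternation : ∀ {x u t} → x ≢ y → XBlocks.Alternation s′ balanced′ recurrent′ x u t → ⊥
    rich-other : ∀ {x} → x ≢ y → ∃[ o ] s o ≡ x → Factors.RichFrom s x → ∃[ o ] s′ o ≡ x × Factors.RichFrom s′ x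
    rich-y : ∀ {x} → x ≢ y → Factors.RichFrom s y → Factors.RichFrom s′ x
    bad′ : ∀ q → BadPair s q → ∃[ q′ ] (length q′ < length q × BadPair s′ q′)

desubstitute : ∀ {k} (s : Word k) → Recurrent s → Balanced s → ∀ y → Counting.Separating s y → Desubstituted s y
desubstitute {k} s rec bal y sep = record
  { s′ = D.s′ ; recurrent′ = D.recurrent′ ; balanced′ = D.balanced′ ; no-alternation = D.no-alternation
  ; rich-other = λ x≢y occ rich → proj₁ (x-occurs x≢y occ) , proj₂ (x-occurs x≢y occ) , D.rich′ x≢y (D.rich-padded x≢y rich)
  ; rich-y = λ x≢y rich → D.rich′ x≢y (λ i si _ L → rich i si (2 + L))
  ; bad′ = BadTransfer.bad′ s rec bal y sep (proj₂ y-occurs) }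
  where
  y-occurs : ∃[ e ] s e ≡ y
  y-occurs with sep 0
  ... | inj₁ h = 0 , h
  ... | inj₂ h = 1 , h
  module D = Desubstitution s rec bal y sep (proj₂ y-occurs)
  x-occurs : ∀ {x} → x ≢ y → ∃[ o ] s o ≡ x → ∃[ o ] D.s′ o ≡ x
  x-occurs {x} x≢y (o , so) with rec [ x ] (o , cong [_] so) (suc (proj₁ y-occurs))
  ... | suc p , s≤s le , h with D.rank le (D.before-≢ (λ w → x≢y (trans (sym (∷-injectiveˡ h)) w)))
  ...   | j , refl = j , ∷-injectiveˡ h

-- The fuel bounds the length of `q`. Since `s′` does not alternate, `some-separating` provides a
-- separating letter of `s′` for the next round, which need not be related to `y`.
no-bad-pair : ∀ fuel {k} (q : List (Fin k)) → length q < fuel → (s : Word k) → Recurrent s → Balanced s →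
  ∀ {x} → ∃[ o ] s o ≡ x → Factors.RichFrom s x → ∀ y → Counting.Separating s y → BadPair s q → ⊥
no-bad-pair (suc fuel) {k} q q< s rec bal {x} occurs rich y sep bad with desubstitute s rec bal y sep
... | record { s′ = s′ ; recurrent′ = rec′ ; balanced′ = bal′ ; no-alternation = no-alternation
             ; rich-other = rich-other ; rich-y = rich-y ; bad′ = bad′ } = go (bad′ q bad)
  where
  continue : ∀ {q′ x′} → length q′ < length q → BadPair s′ q′ → x′ ≢ y → ∃[ o ] s′ o ≡ x′ → Factors.RichFrom s′ x′ → ⊥
  continue {q′} {x′} shorter badq′ x′≢y (o′ , so′) richx′ with XBlocks.next s′ bal′ rec′ x′ o′ so′
  ... | N , nx = XBlocks.some-separating s′ bal′ rec′ x′ xpal so′ nx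
      (λ { nosq m′ refl ne → no-alternation x′≢y (proj₂ (proj₂ (XBlocks.alternation s′ bal′ rec′ x′ xpal nosq o′ m′ so′ nx ne))) })
      (λ y′ sep′ → no-bad-pair fuel q′ (≤-trans shorter (≤-pred q<)) s′ rec′ bal′ (o′ , so′) richx′ y′ sep′ badq′)
    where
    xpal = rich⇒palindromic-returns s′ bal′ rec′ richx′

  first-letter : ∀ {a q′} → RightSpecial s′ (a ∷ q′) → ∃[ o ] s′ o ≡ a
  first-letter (_ , _ , _ , (i , h) , _) = i , ∷-injectiveˡ h

  go : ∃[ q′ ] (length q′ < length q × BadPair s′ q′) → ⊥
  go (q′ , shorter , badq′@(a , b , a≢b , ra , rb)) with x ≟ y
  ... | no x≢y with rich-other x≢y occurs rich
  ...   | o′ , so′ , rich′ = continue shorter badq′ x≢y (o′ , so′) rich′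
  go (q′ , shorter , badq′@(a , b , a≢b , ra , rb)) | yes refl with a ≟ y
  ...   | no a≢y  = continue shorter badq′ a≢y (first-letter ra) (rich-y a≢y rich)
  ...   | yes refl = continue shorter badq′ (λ h → a≢b (sym h)) (first-letter rb) (rich-y (λ h → a≢b (sym h)) rich)

-- `q` is the longest common suffix; equal lengths ensure that a letter precedes it in both words.
last-mismatch : ∀ {k} (u v : List (Fin k)) → length u ≡ length v → u ≢ v →
  ∃[ q ] ∃[ a ] ∃[ b ] (a ≢ b × ∃[ p ] u ≡ p ++ a ∷ q × ∃[ p′ ] v ≡ p′ ++ b ∷ q)
last-mismatch [] [] _ ne = ⊥-elim (ne refl)
last-mismatch (a ∷ u) (b ∷ v) e ne with u ≟ₗ v
... | yes refl = u , a , b , (λ { refl → ne refl }) , [] , refl , [] , refl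
... | no ne′ with last-mismatch u v (suc-injective e) ne′
...   | q , a′ , b′ , a≢b , p , refl , p′ , refl = q , a′ , b′ , a≢b , a ∷ p , refl , b ∷ p′ , refl

factor-suffix : ∀ {k} (s : Word k) p {w} → Factor s (p ++ w) → Factor s w
factor-suffix s []      f       = f
factor-suffix s (a ∷ p) (i , h) = factor-suffix s p (suc i , ∷-injectiveʳ h)

special-suffix : ∀ {k} (s : Word k) p {w} → RightSpecial s (p ++ w) → RightSpecial s w
special-suffix s p {w} (c , d , c≢d , f , g) = c , d , c≢d , cut f , cut g
  where
  cut : ∀ {c} → Factor s ((p ++ w) ++ [ c ]) → Factor s (w ++ [ c ])
  cut {c} f = factor-suffix s p (subst (Factor s) (++-assoc p w [ c ]) f)

unique-special : ∀ {k} (s : Word k) → (∀ q → ¬ BadPair s q) → ∀ u v → length u ≡ length v → RightSpecial s u → RightSpecial s v → u ≡ v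
unique-special s no-bad u v e ru rv with u ≟ₗ v
... | yes h = h
... | no ne with last-mismatch u v e ne
...   | q , a , b , a≢b , p , refl , p′ , refl = ⊥-elim (no-bad q (a , b , a≢b , special-suffix s p ru , special-suffix s p′ rv))

-- The decidable case distinction

module _ {k} (s : Word k) (rec : Recurrent s) (bal : Balanced s) {x : Fin k} (rich : Factors.RichFrom s x)
         {o N : ℕ} (so : s o ≡ x) (nx : XBlocks.Next s bal rec x o N) where
  open XBlocks s bal rec x
  open Counting s

  private
    xpal : PalindromicReturns
    xpal = rich⇒palindromic-returns s bal rec rich

  record Alternates : Set where
    constructor alternates
    field
      long  : 2 ≤ N
      right : s (suc (o + suc N)) ≢ x
      apart : s (suc o) ≢ s (suc (o + suc N))

  -- The letter `z` of a square would occur in every factor of length two. The block ends in two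
  -- letters other than `x`, so `z` is not `x`; then both neighbours of the `x` after the block
  -- would be `z`, against `apart`.
  alternates⇒no-square : Alternates → NoSquare
  alternates⇒no-square (alternates (s≤s (s≤s {n = n} _)) right apart) i sq = go (sep q₋₁) (sep (o + suc N))
    where
    sep : Separating (s i)
    sep = square⇒separating bal i sq
    q₋₂ q₋₁ : ℕ
    q₋₂ = suc o + n
    q₋₁ = suc q₋₂
    at-q₋₁ : s q₋₁ ≡ s (suc o)
    at-q₋₁ = trans (cong s (sym (+-suc (suc o) n))) (trans (xpal o N so nx (suc n) 0 (cong suc (cong suc (+-identityʳ n)))) (cong s (+-identityʳ (suc o))))
    q≡ : suc q₋₁ ≡ o + suc N
    q≡ = lem o n
      where
      lem : ∀ o n → suc (suc (suc o + n)) ≡ o + suc (suc (suc n))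
      lem = solve-∀
    at-q : s (suc q₋₁) ≡ x
    at-q = trans (cong s q≡) (proj₁ nx)
    not-x : s i ≢ x
    not-x h with sep q₋₂
    ... | inj₁ w = proj₂ nx n (n≤1+n _) (trans w h)
    ... | inj₂ w = proj₂ nx (suc n) ≤-refl (trans (cong s (+-suc (suc o) n)) (trans w h))
    go : s q₋₁ ≡ s i ⊎ s (suc q₋₁) ≡ s i → s (o + suc N) ≡ s i ⊎ s (suc (o + suc N)) ≡ s i → ⊥
    go (inj₂ h) _        = not-x (trans (sym h) at-q)
    go (inj₁ _) (inj₁ h) = not-x (trans (sym h) (proj₁ nx))
    go (inj₁ h) (inj₂ g) = apart (trans (sym at-q₋₁) (trans h (sym g)))

  alternates⇒same-frequency : Alternates → ∃[ a ] ∃[ b ] (a ≢ b × SameFrequency s a b)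
  alternates⇒same-frequency alt with gap-odd xpal (alternates⇒no-square alt) so nx
  ... | zero , refl with s≤s () ← Alternates.long alt
  ... | suc m′ , refl = _ , _ , Alternates.apart alt , Frequencies.same-frequency s bal (Alternates.apart alt) z<s
      (LongGaps.Alternating.swapped-shift xpal (alternates⇒no-square alt) {o} {m′} so nx (Alternates.apart alt))

  otherwise⇒episturmian : ¬ Alternates → Episturmian s
  otherwise⇒episturmian ¬alt = Factors.Reversal.closed-under-reversal s rec rich so ,
    unique-special s (λ q bad → some-separating xpal so nx alternating
      (λ y sep → no-bad-pair (suc (length q)) q ≤-refl s rec bal (o , so) rich y sep bad))
    where
    alternating : NoSquare → ∀ m′ → N ≡ suc (suc m′ + suc m′) → s (suc o) ≢ s (suc (o + suc N)) → ⊥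
    alternating nosq m′ refl ne = ¬alt (alternates (s≤s (s≤s z≤n)) (λ h → nosq (o + suc N) (trans (proj₁ nx) (sym h))) ne)

  alternates? : Dec Alternates
  alternates? with 2 ≤? N | s (suc (o + suc N)) ≟ x | s (suc o) ≟ s (suc (o + suc N))
  ... | yes h | no n  | no m  = yes (alternates h n m)
  ... | no h  | _     | _     = no λ a → h (Alternates.long a)
  ... | yes _ | yes e | _     = no λ a → Alternates.right a e
  ... | yes _ | no _  | yes e = no λ a → Alternates.apart a e

theorem5p15 : (k : ℕ) → 2 < k → (s : Word k) →
    (∀ (a : Fin k) → ∃[ i ] s i ≡ a) →
    Recurrent s → Balanced s → FewerOdditiesThan s k →
    Episturmian s ⊎ (∃[ a ] ∃[ b ] (a ≢ b × SameFrequency s a b))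
theorem5p15 k _ s occurs rec bal few with rich-letter s few
... | x , rich with XBlocks.next s bal rec x (proj₁ (occurs x)) (proj₂ (occurs x))
...   | N , nx with alternates? s rec bal rich (proj₂ (occurs x)) nx
...     | yes alt = inj₂ (alternates⇒same-frequency s rec bal rich (proj₂ (occurs x)) nx alt)
...     | no ¬alt = inj₁ (otherwise⇒episturmian s rec bal rich (proj₂ (occurs x)) nx ¬alt)
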